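{- Let $u$ be a (nonempty) packed word. Let $c_u(t)\in\mathbb{K}[t]$ be the polynomial defined by the expansion $$(e^{a_1}e^{a_2}e^{a_3}\cdots)^t=\sum_{u}c_u(t)\,\mathbf{M}_u(A),$$ the sum being over all packed words. Let $I$ be the composition recording the lengths of the maximal nondecreasing runs of $u$, let $J=(j_1,\dots,j_s)$ be the composition recording the lengths of the maximal blocks of consecutive identical letters of $u$, and set $r=\ell(I)$, $s=\ell(J)$. Then $$c_u(t)=\mathcal{F}_{s-r}\big(E^J(t)\big),$$ where $\mathcal{F}_{p}:\mathbb{K}[t]\to\mathbb{K}[t]$ is the linear map with $\mathcal{F}_p(t^k)=\binom{t+p}{k}$ and $$E^J(t)=\prod_{k=1}^{s}\frac{t\,E_{j_k}(t,t+1)}{j_k!},\qquad E_n(x,y)=\sum_{\sigma\in\mathfrak{S}_n}x^{d(\sigma)}y^{\,n-1-d(\sigma)},$$ with $d(\sigma)$ the number of descents of $\sigma$.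
   Context: $\mathbb{K}$ is a field of characteristic $0$. $A=\{a_1<a_2<\cdots\}$ is an infinite totally ordered alphabet of noncommuting variables; letters $a_i$ are also written $i$. For a word $w$ over $A$ whose distinct letters are $b_1<\dots<b_r$, $\mathrm{pack}(w)$ is the word obtained by replacing each $b_i$ by $i$; a word $u$ is packed if $\mathrm{pack}(u)=u$ (i.e. its set of letters is $\{1,\dots,r\}$ for some $r$). For a packed word $u$, $\mathbf{M}_u(A)=\sum_{\mathrm{pack}(w)=u}w$ (formal sum of words over $A$); thus $c_u(t)$ is the coefficient of any word $w$ with $\mathrm{pack}(w)=u$. The product $g=e^{a_1}e^{a_2}\cdots$ is a formal series of words in the noncommuting variables, with constant term $1$, and $g^t=\sum_{k\ge0}\binom{t}{k}(g-1)^k$, where $t$ is an indeterminate commuting with $A$ and $\binom{t+p}{k}=\frac{(t+p)(t+p-1)\cdots(t+p-k+1)}{k!}$. $\ell(I)$ denotes the number of parts of a composition $I$. The maximal nondecreasing runs of $u$ are the factors of the factorization $u=u_1\cdots u_r$ into nondecreasing words such that the last letter of each $u_i$ is strictly greater than the first letter of $u_{i+1}$. The maximal blocks of identical letters are given by writing $u=b_1^{j_1}b_2^{j_2}\cdots b_s^{j_s}$ with $b_i\ne b_{i+1}$. A descent of $\sigma\in\mathfrak{S}_n$ is an index $1\le i<n$ with $\sigma(i)>\sigma(i+1)$. -}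

module Defs where

open import Level using (Level; _⊔_) renaming (suc to lsuc)
open import Algebra.Bundles using (CommutativeRing)
import Algebra.Definitions.RawMonoid as RawMonoidDefs
open import Data.Bool.Base using (if_then_else_)
open import Data.Empty using (⊥-elim)
open import Data.List.Base
  using (List; []; _∷_; [_]; _++_; map; foldr; length; filter; upTo; concatMap; cartesianProductWith)
open import Data.List.Properties
  using (≡-dec; ∷-injective; length-map; length-++; filter-++; filter-accept; filter-reject;
         filter-all; upTo-∷ʳ; map-id-local; map-∘)
open import Data.List.Membership.Propositional using (_∈_; _∉_; find; lose)
open import Data.List.Membership.DecPropositional using () renaming (_∈?_ to mem?)
open import Data.List.Membership.Propositional.Properties
  using (∈-map⁺; ∈-map⁻; ∈-filter⁺; ∈-filter⁻; ∈-upTo⁺; ∈-upTo⁻; ∈-∃++;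
         ∈-concatMap⁺; ∈-concatMap⁻; ∈-cartesianProductWith⁺)
open import Data.List.Relation.Unary.All as All using (All; []; _∷_; all?)
import Data.List.Relation.Unary.All.Properties as AllP
open import Data.List.Relation.Unary.AllPairs as AllPairs using (AllPairs; []; _∷_)
import Data.List.Relation.Unary.AllPairs.Properties as AllPairsP
open import Data.List.Relation.Unary.Any using (here; there)
open import Data.List.Relation.Unary.Unique.Propositional using (Unique)
import Data.List.Relation.Unary.Unique.Propositional.Properties as UniqueP
open import Data.List.Relation.Binary.Permutation.Propositional
  using (_↭_; ↭-refl; ↭-sym; ↭-trans; ↭-reflexive; prep; swap)
open import Data.List.Relation.Binary.Permutation.Propositional.Properties
  using (∈-resp-↭; ↭-length; drop-mid; shift; ++-comm)
open import Data.Nat.Base as ℕ using (ℕ; zero; suc; _∸_; _≤_; _<_; z≤n; s≤s; _!; pred)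
open import Data.Nat.Properties as ℕₚ using (_≟_; _≤?_; _<?_)
open import Data.Product.Base as Prod using (∃; _×_; _,_; proj₁; proj₂)
open import Function.Base using (_∘_; id; case_of_)
open import Relation.Binary.Core using (Rel)
open import Data.List.Relation.Binary.Disjoint.Propositional using (Disjoint)
open import Relation.Binary.Definitions using (Decidable; tri<; tri≈; tri>)
open import Relation.Binary.PropositionalEquality
  using (_≡_; _≢_; refl; sym; trans; cong; subst; subst₂)
open import Relation.Nullary using (Dec; ¬_; yes; no; does; ¬?)
open import Relation.Nullary.Decidable using (dec-true; dec-false)

record Field (a ℓ : Level) : Set (lsuc (a ⊔ ℓ)) where
  field
    commutativeRing : CommutativeRing a ℓ
  open CommutativeRing commutativeRing public
    renaming (refl to reflK; sym to symK; trans to transK)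
  field
    1≉0     : ¬ 1# ≈ 0#
    inverse : ∀ x → ¬ x ≈ 0# → ∃ λ y → x * y ≈ 1#
  open RawMonoidDefs +-rawMonoid public using () renaming (_×_ to infixr 8 _·_)

CharacteristicZero : ∀ {a ℓ} → Field a ℓ → Set ℓ
CharacteristicZero K = ∀ n → n · 1# ≈ 0# → n ≡ 0
  where open Field K

-- The number i stands for the letter a_{i+1}, so the letters of a packed
-- word are {0, …, r-1} rather than {1, …, r}.

Word : Set
Word = List ℕ

infix 4 _∈?_
_∈?_ : (x : ℕ) (w : Word) → Dec (x ∈ w)
_∈?_ = mem? _≟_

-- The number of distinct letters of w that are smaller than b.

rank : Word → ℕ → ℕ
rank w b = length (filter (_∈? w) (upTo b))

pack : Word → Word
pack w = map (rank w) w

Packed : Word → Set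
Packed u = pack u ≡ u

words : ℕ → ℕ → List Word
words m zero    = [ [] ]
words m (suc n) = cartesianProductWith _∷_ (upTo m) (words m n)

-- The packed words of length n; see ∈-packedWords and packedWords-unique.

packedWords : ℕ → List Word
packedWords n = filter (λ u → ≡-dec _≟_ (pack u) u) (words n n)

-- Factorization of a word into its maximal factors whose consecutive
-- letters are all related by R.

attach : ℕ → List Word → List Word
attach x []       = [ [ x ] ]
attach x (f ∷ fs) = (x ∷ f) ∷ fs

factors : ∀ {ℓ} {R : Rel ℕ ℓ} → Decidable R → Word → List Word
factors R? []          = []
factors R? (x ∷ [])    = [ [ x ] ]
factors R? (x ∷ y ∷ w) =
  if does (R? x y) then attach x (factors R? (y ∷ w)) else [ x ] ∷ factors R? (y ∷ w)

runComposition : Word → List ℕ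
runComposition u = map length (factors _≤?_ u)

blockComposition : Word → List ℕ
blockComposition u = map length (factors _≟_ u)

insertions : ℕ → Word → List Word
insertions x []       = [ [ x ] ]
insertions x (y ∷ ys) = (x ∷ y ∷ ys) ∷ map (y ∷_) (insertions x ys)

-- The permutations of {0, …, n-1} in one-line notation, each listed exactly
-- once; see permutations-sound, permutations-complete, permutations-unique.

permutations : ℕ → List Word
permutations zero    = [ [] ]
permutations (suc n) = concatMap (insertions n) (permutations n)

descents : Word → ℕ
descents []          = 0
descents (x ∷ [])    = 0
descents (x ∷ y ∷ w) = (if does (y <? x) then 1 else 0) ℕ.+ descents (y ∷ w)

rank-suc : ∀ w N → rank w (suc N) ≡ rank w N ℕ.+ length (filter (_∈? w) [ N ])
rank-suc w N = trans (cong (length ∘ filter (_∈? w)) (sym (upTo-∷ʳ N)))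
  (trans (cong length (filter-++ (_∈? w) (upTo N) [ N ])) (length-++ (filter (_∈? w) (upTo N))))

rank-suc-∈ : ∀ w {N} → N ∈ w → rank w (suc N) ≡ suc (rank w N)
rank-suc-∈ w {N} N∈w = trans (rank-suc w N)
  (trans (cong (λ l → rank w N ℕ.+ length l) (filter-accept (_∈? w) {N} {[]} N∈w)) (ℕₚ.+-comm (rank w N) 1))

rank-suc-∉ : ∀ w {N} → N ∉ w → rank w (suc N) ≡ rank w N
rank-suc-∉ w {N} N∉w = trans (rank-suc w N)
  (trans (cong (λ l → rank w N ℕ.+ length l) (filter-reject (_∈? w) {N} {[]} N∉w)) (ℕₚ.+-identityʳ (rank w N)))

rank-suc-≤ : ∀ w N → rank w N ≤ rank w (suc N)
rank-suc-≤ w N with N ∈? w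
... | yes N∈w = ℕₚ.≤-trans (ℕₚ.n≤1+n _) (ℕₚ.≤-reflexive (sym (rank-suc-∈ w N∈w)))
... | no  N∉w = ℕₚ.≤-reflexive (sym (rank-suc-∉ w N∉w))

rank-mono : ∀ w {m n} → m ≤ n → rank w m ≤ rank w n
rank-mono w {m} m≤n = go (ℕₚ.≤⇒≤′ m≤n)
  where
  go : ∀ {n} → m ℕ.≤′ n → rank w m ≤ rank w n
  go (ℕ.≤′-reflexive refl) = ℕₚ.≤-refl
  go (ℕ.≤′-step p)         = ℕₚ.≤-trans (go p) (rank-suc-≤ w _)

rank-strict : ∀ w {m n} → m ∈ w → m < n → rank w m < rank w n
rank-strict w m∈w m<n = ℕₚ.≤-trans (ℕₚ.≤-reflexive (sym (rank-suc-∈ w m∈w))) (rank-mono w m<n)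

rank-injective : ∀ w {m n} → m ∈ w → n ∈ w → rank w m ≡ rank w n → m ≡ n
rank-injective w {m} {n} m∈w n∈w eq with ℕₚ.<-cmp m n
... | tri< m<n _ _ = ⊥-elim (ℕₚ.<⇒≢ (rank-strict w m∈w m<n) eq)
... | tri≈ _ m≡n _ = m≡n
... | tri> _ _ n<m = ⊥-elim (ℕₚ.<⇒≢ (rank-strict w n∈w n<m) (sym eq))

rank-pack : ∀ w N → rank (pack w) (rank w N) ≡ rank w N
rank-pack w zero = refl
rank-pack w (suc N) with N ∈? w
... | yes N∈w = trans (cong (rank (pack w)) (rank-suc-∈ w N∈w))
  (trans (rank-suc-∈ (pack w) (∈-map⁺ (rank w) N∈w))
         (trans (cong suc (rank-pack w N)) (sym (rank-suc-∈ w N∈w))))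
... | no  N∉w = trans (cong (rank (pack w)) (rank-suc-∉ w N∉w))
  (trans (rank-pack w N) (sym (rank-suc-∉ w N∉w)))

pack-packed : ∀ w → Packed (pack w)
pack-packed w = map-id-local (AllP.map⁺ (All.universal (rank-pack w) w))

unique-length : ∀ {xs ys : Word} → Unique xs → (∀ {x} → x ∈ xs → x ∈ ys) → length xs ≤ length ys
unique-length {[]} _ _ = z≤n
unique-length {x ∷ xs} {ys} (x≢ ∷ xs!) sub with ∈-∃++ (sub (here refl))
... | as , bs , refl = ℕₚ.≤-trans (s≤s (unique-length xs! sub′)) (ℕₚ.≤-reflexive (sym (↭-length (shift x as bs))))
  where
  sub′ : ∀ {y} → y ∈ xs → y ∈ as ++ bs
  sub′ y∈xs with ∈-resp-↭ (shift x as bs) (sub (there y∈xs))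
  ... | here y≡x = ⊥-elim (All.lookup x≢ y∈xs (sym y≡x))
  ... | there y∈ = y∈

rank<length : ∀ w {b} → b ∈ w → rank w b < length w
rank<length w {b} b∈w = unique-length (fresh ∷ UniqueP.filter⁺ (_∈? w) (UniqueP.upTo⁺ b)) sub
  where
  fresh : All (b ≢_) (filter (_∈? w) (upTo b))
  fresh = All.tabulate λ x∈ b≡x →
    ℕₚ.<⇒≢ (∈-upTo⁻ (proj₁ (∈-filter⁻ (_∈? w) x∈))) (sym b≡x)
  sub : ∀ {x} → x ∈ b ∷ filter (_∈? w) (upTo b) → x ∈ w
  sub (here refl) = b∈w
  sub (there x∈)  = proj₂ (∈-filter⁻ (_∈? w) {xs = upTo b} x∈)

∈-words : ∀ {m} u → All (_< m) u → u ∈ words m (length u)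
∈-words []      []         = here refl
∈-words (x ∷ u) (x<m ∷ u<) = ∈-cartesianProductWith⁺ _∷_ (∈-upTo⁺ x<m) (∈-words u u<)

words-unique : ∀ m n → Unique (words m n)
words-unique m zero    = [] ∷ []
words-unique m (suc n) =
  UniqueP.cartesianProductWith⁺ _∷_ ∷-injective (UniqueP.upTo⁺ m) (words-unique m n)

packed-letters : ∀ u → Packed u → All (_< length u) u
packed-letters u pu = subst (All (_< length u)) pu (AllP.map⁺ (All.tabulate (rank<length u)))

∈-packedWords : ∀ u → Packed u → u ∈ packedWords (length u)
∈-packedWords u pu = ∈-filter⁺ _ (∈-words u (packed-letters u pu)) pu

packedWords-unique : ∀ n → Unique (packedWords n)
packedWords-unique n = UniqueP.filter⁺ _ (words-unique n n)

-- ℓ(I) ≤ ℓ(J), so that the truncated subtraction s ∸ r is the subtraction.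

length-attach : ∀ x fs → length (attach x fs) ≡ suc (pred (length fs))
length-attach x []       = refl
length-attach x (f ∷ fs) = refl

factors-≤ : ∀ {ℓ ℓ′} {R : Rel ℕ ℓ} {S : Rel ℕ ℓ′} (R? : Decidable R) (S? : Decidable S) →
            (∀ {x y} → S x y → R x y) → ∀ u → length (factors R? u) ≤ length (factors S? u)
factors-≤ R? S? S⇒R []          = z≤n
factors-≤ R? S? S⇒R (x ∷ [])    = s≤s z≤n
factors-≤ R? S? S⇒R (x ∷ y ∷ w) with R? x y | S? x y | factors-≤ R? S? S⇒R (y ∷ w)
... | yes _ | yes _ | ih = subst₂ _≤_ (sym (length-attach x (factors R? (y ∷ w))))
                                      (sym (length-attach x (factors S? (y ∷ w))))
                                      (s≤s (ℕₚ.pred-mono-≤ ih))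
... | yes _ | no _  | ih = subst (_≤ _) (sym (length-attach x (factors R? (y ∷ w))))
                                 (s≤s (ℕₚ.≤-trans ℕₚ.pred[n]≤n ih))
... | no _  | no _  | ih = s≤s ih
... | no ¬r | yes s | _  = ⊥-elim (¬r (S⇒R s))

runs≤blocks : ∀ u → length (runComposition u) ≤ length (blockComposition u)
runs≤blocks u = subst₂ _≤_ (sym (length-map length (factors _≤?_ u)))
                           (sym (length-map length (factors _≟_ u)))
                           (factors-≤ _≤?_ _≟_ ℕₚ.≤-reflexive u)

insertions-↭ : ∀ x τ {σ} → σ ∈ insertions x τ → σ ↭ x ∷ τ
insertions-↭ x []      (here refl) = ↭-refl
insertions-↭ x (y ∷ τ) (here refl) = ↭-refl
insertions-↭ x (y ∷ τ) (there σ∈) with ∈-map⁻ (y ∷_) σ∈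
... | ρ , ρ∈ , refl = ↭-trans (prep y (insertions-↭ x τ ρ∈)) (swap y x ↭-refl)

upTo-suc-↭ : ∀ n → n ∷ upTo n ↭ upTo (suc n)
upTo-suc-↭ n = ↭-trans (++-comm [ n ] (upTo n)) (↭-reflexive (upTo-∷ʳ n))

permutations-sound : ∀ n {σ} → σ ∈ permutations n → σ ↭ upTo n
permutations-sound zero    (here refl) = ↭-refl
permutations-sound (suc n) σ∈ with find (∈-concatMap⁻ (insertions n) σ∈)
... | τ , τ∈ , σ∈τ = ↭-trans (insertions-↭ n τ σ∈τ)
                       (↭-trans (prep n (permutations-sound n τ∈)) (upTo-suc-↭ n))

∈-insertions : ∀ x as bs → as ++ [ x ] ++ bs ∈ insertions x (as ++ bs)
∈-insertions x []       []       = here refl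
∈-insertions x []       (b ∷ bs) = here refl
∈-insertions x (a ∷ as) bs       = there (∈-map⁺ (a ∷_) (∈-insertions x as bs))

permutations-complete : ∀ n {σ} → σ ↭ upTo n → σ ∈ permutations n
permutations-complete zero {[]}    _ = here refl
permutations-complete zero {x ∷ σ} p with ↭-length p
... | ()
permutations-complete (suc n) {σ} p
  with ∈-∃++ (∈-resp-↭ (↭-sym p) (∈-resp-↭ (upTo-suc-↭ n) (here refl)))
... | as , bs , refl = ∈-concatMap⁺ (insertions n)
  (lose (permutations-complete n (drop-mid as [] (↭-trans p (↭-sym (upTo-suc-↭ n)))))
        (∈-insertions n as bs))

insertions-unique : ∀ x τ → x ∉ τ → Unique (insertions x τ)
insertions-unique x []      _   = [] ∷ []
insertions-unique x (y ∷ τ) x∉ =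
  AllP.map⁺ (All.universal (λ _ eq → x∉ (here (proj₁ (∷-injective eq)))) _)
  ∷ UniqueP.map⁺ (proj₂ ∘ ∷-injective) (insertions-unique x τ (x∉ ∘ there))

insertions-remove : ∀ x τ {σ} → x ∉ τ → σ ∈ insertions x τ → filter (λ y → ¬? (y ≟ x)) σ ≡ τ
insertions-remove x [] _ (here refl) = filter-reject (λ y → ¬? (y ≟ x)) {x} {[]} (λ ¬p → ¬p refl)
insertions-remove x (y ∷ τ) x∉ (here refl) =
  trans (filter-reject (λ y → ¬? (y ≟ x)) {x} {y ∷ τ} (λ ¬p → ¬p refl))
        (filter-all (λ y → ¬? (y ≟ x)) (All.tabulate λ z∈ z≡x → x∉ (subst (_∈ y ∷ τ) z≡x z∈)))
insertions-remove x (y ∷ τ) x∉ (there σ∈) with ∈-map⁻ (y ∷_) σ∈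
... | ρ , ρ∈ , refl =
  trans (filter-accept (λ y → ¬? (y ≟ x)) {y} {ρ} (λ y≡x → x∉ (here (sym y≡x))))
        (cong (y ∷_) (insertions-remove x τ (x∉ ∘ there) ρ∈))

permutations-unique : ∀ n → Unique (permutations n)
permutations-unique zero    = [] ∷ []
permutations-unique (suc n) = UniqueP.concat⁺
  (AllP.map⁺ (All.tabulate λ {τ} τ∈ → insertions-unique n τ (fresh τ∈)))
  (AllPairsP.map⁺ (disjoint (permutations n) fresh (permutations-unique n)))
  where
  fresh : ∀ {τ} → τ ∈ permutations n → n ∉ τ
  fresh τ∈ n∈τ = ℕₚ.<-irrefl refl (∈-upTo⁻ (∈-resp-↭ (permutations-sound n τ∈) n∈τ))
  disjoint : ∀ ts → (∀ {τ} → τ ∈ ts → n ∉ τ) → Unique ts →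
             AllPairs (λ τ τ′ → Disjoint (insertions n τ) (insertions n τ′)) ts
  disjoint []       _ []          = []
  disjoint (τ ∷ ts) f (τ≢ ∷ ts!) =
    All.tabulate (λ {τ′} τ′∈ (σ∈ , σ∈′) → All.lookup τ≢ τ′∈
      (trans (sym (insertions-remove n τ (f (here refl)) σ∈))
             (insertions-remove n τ′ (f (there τ′∈)) σ∈′)))
    ∷ disjoint ts (f ∘ there) ts!

module Over {a ℓ} (K : Field a ℓ) (char0 : CharacteristicZero K) where

  open Field K

  n!≉0 : ∀ n → ¬ (n !) · 1# ≈ 0#
  n!≉0 n eq = ℕₚ.m<n⇒n≢0 (ℕₚ.1≤n! n) (char0 (n !) eq)

  1/_! : ℕ → Carrier
  1/ n ! = proj₁ (inverse ((n !) · 1#) (n!≉0 n))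

  ∑ : ∀ {i} {I : Set i} → List I → (I → Carrier) → Carrier
  ∑ xs f = foldr (λ x s → f x + s) 0# xs

  -- A polynomial in t is the list of its coefficients, constant term first;
  -- _≈ₚ_ ignores trailing zeros.

  K[t] : Set a
  K[t] = List Carrier

  coeff : K[t] → ℕ → Carrier
  coeff []      _       = 0#
  coeff (a ∷ p) zero    = a
  coeff (a ∷ p) (suc n) = coeff p n

  infix 4 _≈ₚ_
  _≈ₚ_ : K[t] → K[t] → Set ℓ
  p ≈ₚ q = ∀ n → coeff p n ≈ coeff q n

  infixl 6 _+ₚ_
  infixl 7 _*ₚ_
  infixr 7 _•_
  infixr 8 _^ₚ_

  _+ₚ_ : K[t] → K[t] → K[t]
  []      +ₚ q       = q
  (a ∷ p) +ₚ []      = a ∷ p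
  (a ∷ p) +ₚ (b ∷ q) = (a + b) ∷ (p +ₚ q)

  _•_ : Carrier → K[t] → K[t]
  a • p = map (a *_) p

  _*ₚ_ : K[t] → K[t] → K[t]
  []      *ₚ q = []
  (a ∷ p) *ₚ q = (a • q) +ₚ (0# ∷ (p *ₚ q))

  1ₚ : K[t]
  1ₚ = [ 1# ]

  t : K[t]
  t = 0# ∷ 1# ∷ []

  const : Carrier → K[t]
  const a = [ a ]

  _^ₚ_ : K[t] → ℕ → K[t]
  p ^ₚ zero  = 1ₚ
  p ^ₚ suc n = p *ₚ (p ^ₚ n)

  ∑ₚ : ∀ {i} {I : Set i} → List I → (I → K[t]) → K[t]
  ∑ₚ xs f = foldr (λ x s → f x +ₚ s) [] xs

  ∏ₚ : ∀ {i} {I : Set i} → List I → (I → K[t]) → K[t]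
  ∏ₚ xs f = foldr (λ x s → f x *ₚ s) 1ₚ xs

  -- binomial p k is the polynomial (t+p)(t+p-1)⋯(t+p-k+1)/k!.

  binomial : ℕ → ℕ → K[t]
  binomial p k = 1/ k ! • ∏ₚ (upTo k) (λ i → t +ₚ const (p · 1# - i · 1#))

  -- The linear map sending t^k to binomial p k.

  ℱ : ℕ → K[t] → K[t]
  ℱ p q = ∑ₚ (upTo (length q)) (λ k → coeff q k • binomial p k)

  -- Used for n ≥ 1 only, where descents σ ≤ n ∸ 1.

  Eulerian : ℕ → K[t] → K[t] → K[t]
  Eulerian n x y =
    ∑ₚ (permutations n) (λ σ → x ^ₚ descents σ *ₚ y ^ₚ (n ∸ 1 ∸ descents σ))

  E : List ℕ → K[t]
  E J = ∏ₚ J (λ j → 1/ j ! • (t *ₚ Eulerian j t (t +ₚ 1ₚ)))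

  -- A formal series is given by its coefficients.

  Series : Set a
  Series = Word → Carrier

  splits : Word → List (Word × Word)
  splits []      = [ ([] , []) ]
  splits (x ∷ w) = ([] , x ∷ w) ∷ map (Prod.map₁ (x ∷_)) (splits w)

  infixl 6 _-ₛ_
  infixl 7 _*ₛ_
  infixr 8 _^ₛ_

  1ₛ : Series
  1ₛ []      = 1#
  1ₛ (_ ∷ _) = 0#

  _-ₛ_ : Series → Series → Series
  (f -ₛ h) w = f w - h w

  _*ₛ_ : Series → Series → Series
  (f *ₛ h) w = ∑ (splits w) (λ (u , v) → f u * h v)

  _^ₛ_ : Series → ℕ → Series
  f ^ₛ zero  = 1ₛ
  f ^ₛ suc k = f *ₛ (f ^ₛ k)

  exp : ℕ → Series
  exp x w = if does (all? (_≟ x) w) then 1/ length w ! else 0#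

  -- partialProduct N is the product of the exponentials of the first N letters.

  partialProduct : ℕ → Series
  partialProduct zero    = 1ₛ
  partialProduct (suc N) = partialProduct N *ₛ exp N

  -- The least strict upper bound of the letters of w.

  bound : Word → ℕ
  bound = foldr (λ x m → suc x ℕ.⊔ m) 0

  -- The infinite product of all the exponentials: the coefficient of w in
  -- partialProduct N is constant for N ≥ bound w (partialProduct-stable).

  g : Series
  g w = partialProduct (bound w) w

  -- The coefficient of w in f^t = ∑_{k ≥ 0} binom(t,k) (f-1)^k, for a series f
  -- with constant term 1; the terms with k > length w vanish there
  -- (power-vanishes).

  infix 9 _^ᵗ
  _^ᵗ : Series → Word → K[t]
  (f ^ᵗ) w = ∑ₚ (upTo (suc (length w))) (λ k → ((f -ₛ 1ₛ) ^ₛ k) w • binomial 0 k)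

  M : Word → Series
  M u w = if does (≡-dec _≟_ (pack w) u) then 1# else 0#

  -- The coefficient of w in ∑_u c_u M_u over all packed words u. Only packed
  -- words as long as w contribute. Values of c at other words are not used.

  ∑M : (Word → K[t]) → Word → K[t]
  ∑M c w = ∑ₚ (packedWords (length w)) (λ u → M u w • c u)

  -- g^t = ∑_u c_u M_u. Such a c exists and is unique on packed words; see
  -- expansion and expansion-unique.

  IsExpansion : (Word → K[t]) → Set ℓ
  IsExpansion c = ∀ w → (g ^ᵗ) w ≈ₚ ∑M c w

  private
    variable
      i   : Level
      I I′ : Set i

  ∑-cong : ∀ (xs : List I) {f h : I → Carrier} → (∀ {x} → x ∈ xs → f x ≈ h x) → ∑ xs f ≈ ∑ xs h
  ∑-cong []       _  = reflK
  ∑-cong (x ∷ xs) eq = +-cong (eq (here refl)) (∑-cong xs (eq ∘ there))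

  ∑-zero : ∀ (xs : List I) {f : I → Carrier} → (∀ {x} → x ∈ xs → f x ≈ 0#) → ∑ xs f ≈ 0#
  ∑-zero []       _  = reflK
  ∑-zero (x ∷ xs) eq = transK (+-cong (eq (here refl)) (∑-zero xs (eq ∘ there))) (+-identityˡ 0#)

  ∑-map : ∀ (φ : I → I′) (xs : List I) (f : I′ → Carrier) → ∑ (map φ xs) f ≡ ∑ xs (f ∘ φ)
  ∑-map φ []       f = refl
  ∑-map φ (x ∷ xs) f = cong (f (φ x) +_) (∑-map φ xs f)

  ∑-single : ∀ (xs : List I) {f : I → Carrier} {x} → Unique xs → x ∈ xs →
             (∀ {y} → y ≢ x → f y ≈ 0#) → ∑ xs f ≈ f x
  ∑-single (x ∷ xs) (x≢ ∷ _) (here refl) z =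
    transK (+-congˡ (∑-zero xs λ y∈ → z (λ y≡x → All.lookup x≢ y∈ (sym y≡x)))) (+-identityʳ _)
  ∑-single (y ∷ xs) (y≢ ∷ xs!) (there x∈) z =
    transK (+-cong (z (All.lookup y≢ x∈)) (∑-single xs xs! x∈ z)) (+-identityˡ _)

  coeff-+ : ∀ p q n → coeff (p +ₚ q) n ≈ coeff p n + coeff q n
  coeff-+ []      q       n       = symK (+-identityˡ _)
  coeff-+ (a ∷ p) []      n       = symK (+-identityʳ _)
  coeff-+ (a ∷ p) (b ∷ q) zero    = reflK
  coeff-+ (a ∷ p) (b ∷ q) (suc n) = coeff-+ p q n

  coeff-• : ∀ a p n → coeff (a • p) n ≈ a * coeff p n
  coeff-• a []      n       = symK (zeroʳ a)
  coeff-• a (b ∷ p) zero    = reflK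
  coeff-• a (b ∷ p) (suc n) = coeff-• a p n

  coeff-∑ : ∀ (xs : List I) (f : I → Carrier) (p : I → K[t]) n →
            coeff (∑ₚ xs (λ x → f x • p x)) n ≈ ∑ xs (λ x → f x * coeff (p x) n)
  coeff-∑ []       f p n = reflK
  coeff-∑ (x ∷ xs) f p n =
    transK (coeff-+ (f x • p x) _ n) (+-cong (coeff-• (f x) (p x) n) (coeff-∑ xs f p n))

  splits-++ : ∀ w {u v} → (u , v) ∈ splits w → u ++ v ≡ w
  splits-++ []      (here refl) = refl
  splits-++ (x ∷ w) (here refl) = refl
  splits-++ (x ∷ w) (there uv∈) with ∈-map⁻ (Prod.map₁ (x ∷_)) uv∈
  ... | _ , uv∈′ , refl = cong (x ∷_) (splits-++ w uv∈′)

  power-vanishes : ∀ f → f [] ≈ 0# → ∀ k w → length w < k → (f ^ₛ k) w ≈ 0#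
  power-vanishes f f[] (suc k) w (s≤s |w|≤k) = ∑-zero (splits w) term
    where
    term : ∀ {uv} → uv ∈ splits w → f (proj₁ uv) * (f ^ₛ k) (proj₂ uv) ≈ 0#
    term {[] , v}    _   = transK (*-congʳ f[]) (zeroˡ _)
    term {x ∷ u , v} uv∈ = transK (*-congˡ (power-vanishes f f[] k v |v|<k)) (zeroʳ _)
      where
      |v|<k : length v < k
      |v|<k = ℕₚ.≤-trans (s≤s (ℕₚ.m≤n+m (length v) (length u)))
        (ℕₚ.≤-trans (ℕₚ.≤-reflexive (trans (sym (length-++ (x ∷ u))) (cong length (splits-++ w uv∈)))) |w|≤k)

  1/0!≈1 : 1/ 0 ! ≈ 1#
  1/0!≈1 = transK (symK (*-identityˡ _))
    (transK (*-congʳ (symK (+-identityʳ 1#))) (proj₂ (inverse ((0 !) · 1#) (n!≉0 0))))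

  if-yes : ∀ {p} {P : Set p} (P? : Dec P) → P → ∀ {x y} → (if does P? then x else y) ≈ x
  if-yes P? p {x} {y} = reflexive (cong (λ b → if b then x else y) (dec-true P? p))

  if-no : ∀ {p} {P : Set p} (P? : Dec P) → ¬ P → ∀ {x y} → (if does P? then x else y) ≈ y
  if-no P? ¬p {x} {y} = reflexive (cong (λ b → if b then x else y) (dec-false P? ¬p))

  exp-∉ : ∀ {x y} v → y ≢ x → exp x (y ∷ v) ≈ 0#
  exp-∉ {x} {y} v y≢x = if-no (all? (_≟ x) (y ∷ v)) (λ { (y≡x ∷ _) → y≢x y≡x })

  *-exp-∉ : ∀ {x} f w → x ∉ w → (f *ₛ exp x) w ≈ f w
  *-exp-∉     f []      x∉ = transK (+-identityʳ _) (transK (*-congˡ 1/0!≈1) (*-identityʳ _))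
  *-exp-∉ {x} f (y ∷ w) x∉ = transK
    (+-cong (transK (*-congˡ (exp-∉ w (x∉ ∘ here ∘ sym))) (zeroʳ _))
            (transK (reflexive (∑-map (Prod.map₁ (y ∷_)) (splits w) _)) (*-exp-∉ (f ∘ (y ∷_)) w (x∉ ∘ there))))
    (+-identityˡ _)

  ∈-bound : ∀ {w x} → x ∈ w → x < bound w
  ∈-bound {y ∷ w} (here refl) = ℕₚ.m≤m⊔n (suc y) (bound w)
  ∈-bound {y ∷ w} (there x∈)  = ℕₚ.≤-trans (∈-bound x∈) (ℕₚ.m≤n⊔m (suc y) (bound w))

  partialProduct-stable : ∀ w {N} → bound w ≤ N → partialProduct N w ≈ g w
  partialProduct-stable w b≤N = go (ℕₚ.≤⇒≤′ b≤N)
    where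
    go : ∀ {N} → bound w ℕ.≤′ N → partialProduct N w ≈ g w
    go (ℕ.≤′-reflexive refl) = reflK
    go (ℕ.≤′-step {N} p)     = transK
      (*-exp-∉ (partialProduct N) w (λ N∈ → ℕₚ.<⇒≱ (∈-bound N∈) (ℕₚ.≤′⇒≤ p))) (go p)

  module _ (S : Word) where

    private
      φ : ℕ → ℕ
      φ = rank S

    PackInvariant : Series → Set ℓ
    PackInvariant f = ∀ v → All (_∈ S) v → f (map φ v) ≈ f v

    splits-map : ∀ v → splits (map φ v) ≡ map (Prod.map (map φ) (map φ)) (splits v)
    splits-map []      = refl
    splits-map (x ∷ v) = cong (([] , map φ (x ∷ v)) ∷_)
      (trans (cong (map (Prod.map₁ (φ x ∷_))) (splits-map v))
             (trans (sym (map-∘ (splits v))) (map-∘ (splits v))))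

    *-invariant : ∀ {f f′ h h′ : Series} →
                  (∀ v → All (_∈ S) v → f′ (map φ v) ≈ f v) →
                  (∀ v → All (_∈ S) v → h′ (map φ v) ≈ h v) →
                  ∀ v → All (_∈ S) v → (f′ *ₛ h′) (map φ v) ≈ (f *ₛ h) v
    *-invariant {f} {f′} {h} {h′} ff hh v v⊆S = transK
      (reflexive (trans (cong (λ l → ∑ l (λ (a , b) → f′ a * h′ b)) (splits-map v))
                        (∑-map _ (splits v) _)))
      (∑-cong (splits v) λ {(a , b)} ab∈ →
        let ab⊆S = subst (All (_∈ S)) (sym (splits-++ v ab∈)) v⊆S in
        *-cong (ff a (AllP.++⁻ˡ a ab⊆S)) (hh b (AllP.++⁻ʳ a ab⊆S)))

    1-invariant : PackInvariant 1ₛ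
    1-invariant []      _ = reflK
    1-invariant (_ ∷ _) _ = reflK

    exp-invariant : ∀ {N} → N ∈ S → ∀ v → All (_∈ S) v → exp (φ N) (map φ v) ≈ exp N v
    exp-invariant {N} N∈S v v⊆S = case all? (_≟ N) v of λ where
      (yes q) → transK (if-yes (all? (_≟ φ N) (map φ v)) (AllP.map⁺ (All.map (cong φ) q)))
        (transK (reflexive (cong 1/_! (length-map φ v))) (symK (if-yes (all? (_≟ N) v) q)))
      (no ¬q) → transK
        (if-no (all? (_≟ φ N) (map φ v)) (λ p → ¬q (All.zipWith
          (λ (x∈S , eq) → rank-injective S x∈S N∈S eq) (v⊆S , AllP.map⁻ p))))
        (symK (if-no (all? (_≟ N) v) ¬q))

    partialProduct-invariant : ∀ N v → All (_∈ S) v →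
                               partialProduct (φ N) (map φ v) ≈ partialProduct N v
    partialProduct-invariant zero    v v⊆S = 1-invariant v v⊆S
    partialProduct-invariant (suc N) v v⊆S with N ∈? S
    ... | yes N∈S = transK (reflexive (cong (λ m → partialProduct m (map φ v)) (rank-suc-∈ S N∈S)))
      (*-invariant (partialProduct-invariant N) (exp-invariant N∈S) v v⊆S)
    ... | no  N∉S = transK (reflexive (cong (λ m → partialProduct m (map φ v)) (rank-suc-∉ S N∉S)))
      (transK (partialProduct-invariant N v v⊆S)
              (symK (*-exp-∉ (partialProduct N) v (λ N∈v → N∉S (All.lookup v⊆S N∈v)))))

    bound-map : ∀ v → All (_∈ S) v → bound (map φ v) ≤ φ (bound v)
    bound-map []      []           = z≤n
    bound-map (x ∷ v) (x∈S ∷ v⊆S) = ℕₚ.⊔-lub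
      (rank-strict S x∈S (ℕₚ.m≤m⊔n (suc x) (bound v)))
      (ℕₚ.≤-trans (bound-map v v⊆S) (rank-mono S (ℕₚ.m≤n⊔m (suc x) (bound v))))

    g-invariant : PackInvariant g
    g-invariant v v⊆S = transK (symK (partialProduct-stable (map φ v) (bound-map v v⊆S)))
                               (partialProduct-invariant (bound v) v v⊆S)

    power-invariant : ∀ {f} → PackInvariant f → ∀ k → PackInvariant (f ^ₛ k)
    power-invariant ff zero    = 1-invariant
    power-invariant ff (suc k) = *-invariant ff (power-invariant ff k)

  g^ᵗ-pack : ∀ w → (g ^ᵗ) (pack w) ≈ₚ (g ^ᵗ) w
  g^ᵗ-pack w n rewrite length-map (rank w) w = transK (coeff-∑ ks (λ k → h^ k (pack w)) (binomial 0) n)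
    (transK (∑-cong ks λ {k} _ → *-congʳ (power-invariant w {h} h-inv k w (All.tabulate id)))
            (symK (coeff-∑ ks (λ k → h^ k w) (binomial 0) n)))
    where
    ks = upTo (suc (length w))
    h = g -ₛ 1ₛ
    h^ : ℕ → Series
    h^ k = h ^ₛ k
    h-inv : PackInvariant w h
    h-inv v v⊆w = +-cong (g-invariant w v v⊆w) (-‿cong (1-invariant w v v⊆w))

  ∑M-coeff : ∀ c w → ∑M c w ≈ₚ c (pack w)
  ∑M-coeff c w n = transK (coeff-∑ (packedWords (length w)) _ c n)
    (transK (∑-single (packedWords (length w)) (packedWords-unique (length w))
              (subst (λ m → pack w ∈ packedWords m) (length-map (rank w) w)
                     (∈-packedWords (pack w) (pack-packed w)))
              off)
            on)
    where
    off : ∀ {u} → u ≢ pack w → M u w * coeff (c u) n ≈ 0#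
    off {u} u≢ = transK (*-congʳ (if-no (≡-dec _≟_ (pack w) u) (u≢ ∘ sym))) (zeroˡ _)
    on : M (pack w) w * coeff (c (pack w)) n ≈ coeff (c (pack w)) n
    on = transK (*-congʳ (if-yes (≡-dec _≟_ (pack w) (pack w)) refl)) (*-identityˡ _)

  expansion : IsExpansion (g ^ᵗ)
  expansion w n = symK (transK (∑M-coeff (g ^ᵗ) w n) (g^ᵗ-pack w n))

  expansion-unique : ∀ c → IsExpansion c → ∀ u → Packed u → c u ≈ₚ (g ^ᵗ) u
  expansion-unique c c-exp u pu n = transK
    (reflexive (cong (λ v → coeff (c v) n) (sym pu)))
    (transK (symK (∑M-coeff c u n)) (symK (c-exp u n)))

{-# OPTIONS --safe #-}

-- Put h = g − 1 and H u = ∑ₖ (h^k)(u) t^k, the generating polynomial of the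
-- weighted cuttings of u into nonempty nondecreasing factors, by number of
-- factors. Then c_u = ℱ₀(H u). Between two blocks a cut is forced at a descent
-- and optional at an ascent, hence t H(pq) = t H(p)H(q), respectively
-- (t+1) H(p)H(q). For a single block x^n, differentiating (e^z − 1)^k gives
-- (n+1) H(x^{n+1}) = t d/dt((t+1) H(x^n)), and inserting n+1 into permutations
-- of n gives E_{n+1}(t,t+1) = d/dt(t(t+1) E_n(t,t+1)); so H(x^n) is
-- t E_n(t,t+1)/n!. Altogether t^{s-r} H u = (t+1)^{s-r} E^J, and the claim
-- follows from Pascal's rule in the form ℱ_p(t^p q) = ℱ_0((t+1)^p q).

module Submission where

open import Defs
open import Algebra.Bundles using (CommutativeSemiring)
import Algebra.Properties.AbelianGroup as AbelianGroupProperties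
import Algebra.Properties.CommutativeMonoid.Mult as CommutativeMonoidMult
import Algebra.Properties.Ring as RingProperties
import Algebra.Properties.Semiring.Mult as SemiringMult
import Algebra.Solver.Ring.NaturalCoefficients.Default as SemiringSolver
open import Algebra.Structures.Biased using (isCommutativeSemiringˡ)
open import Data.Bool.Base using (true; false; if_then_else_)
open import Data.Empty using (⊥-elim)
open import Data.List.Base
  using (List; []; _∷_; [_]; _++_; map; length; upTo; applyUpTo; replicate; concatMap)
open import Data.List.Membership.Propositional using (_∈_)
open import Data.List.Membership.Propositional.Properties using (∈-++⁺ˡ; ∈-++⁺ʳ; ∈-++⁻; ∈-upTo⁻)
open import Data.List.Properties
  using (map-++; map-∘; map-upTo; upTo-∷ʳ; ++-assoc; ++-identityʳ; length-++; length-map;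
         length-replicate; length-applyUpTo; length-upTo)
open import Data.List.Relation.Binary.Permutation.Propositional using (_↭_)
open import Data.List.Relation.Binary.Permutation.Propositional.Properties using (∈-resp-↭; ↭-length)
open import Data.List.Relation.Unary.All as All using (All; []; _∷_; all?)
import Data.List.Relation.Unary.All.Properties as AllP
open import Data.List.Relation.Unary.Any using (here; there)
open import Data.Nat.Base as ℕ using (ℕ; zero; suc; pred; _!; _<_; _≤_; _∸_; z≤n; s≤s)
open import Data.Nat.Properties as ℕₚ using (_≟_; _≤?_; _<?_)
open import Data.Product.Base as Prod using (_×_; _,_; proj₁; proj₂)
open import Data.Sum.Base using (inj₁; inj₂)
open import Function.Base using (_∘_)
open import Level using (_⊔_)
open import Relation.Binary.Core using (Rel)
open import Relation.Binary.Definitions using (Decidable; tri<; tri≈; tri>)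
open import Relation.Binary.PropositionalEquality
  using (_≡_; _≢_; refl; sym; trans; cong; cong₂; subst)
import Relation.Binary.Reasoning.Setoid as SetoidReasoning
open import Relation.Binary.Structures using (IsEquivalence)
open import Relation.Nullary using (¬_; yes; no; does)
open import Relation.Nullary.Decidable using (dec-true; dec-false)

-- Each exponential in the ordered product contributes a power of a single letter, in increasing
-- order; so `h` vanishes across a descent and is multiplicative across a strict ascent. In the
-- junction rule the factor is t + ε with ε = 0 or 1: a cut contributes H(p) H(q), while no cut
-- merges two factors into one and saves a t. Pascal's rule needs more than t^{s-r} H u =
-- (t+1)^{s-r} E^J: it needs one polynomial q with E^J = t^{s-r} q and H u = (t+1)^{s-r} q. Such a q
-- exists because the polynomial of every block is divisible by t, and each ascent between blocks
-- takes one factor t from the block on its left. The induction over blocks therefore carries q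
-- along instead of dividing at the end. The exponent s - r counts the ascents among the s - 1
-- boundaries between blocks, the other r - 1 being descents.

-- Cauchy products of sequences and the Leibniz rule.

module Convolution {a ℓ} (R : CommutativeSemiring a ℓ) where

  open CommutativeSemiring R hiding (zero)
    renaming (refl to reflR; sym to symR; trans to transR)
  open SemiringMult semiring using (×-comm-*) renaming (_×_ to infixr 8 _·_)
  open CommutativeMonoidMult +-commutativeMonoid using (×-distrib-+)
  open SemiringSolver R
  open SetoidReasoning setoid

  Sequence : Set a
  Sequence = ℕ → Carrier

  infixl 7 _⋆_
  -- The Cauchy product without index subtraction. `_*ₚ_` on coefficient lists and `splits` on
  -- powers of a letter follow the same recursion, so both reduce to it directly.
  _⋆_ : Sequence → Sequence → Sequence
  (f ⋆ g) zero    = f 0 * g 0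
  (f ⋆ g) (suc n) = f 0 * g (suc n) + (f ∘ suc ⋆ g) n

  ⋆-cong : ∀ {f f′ g g′} → (∀ n → f n ≈ f′ n) → (∀ n → g n ≈ g′ n) → ∀ n → (f ⋆ g) n ≈ (f′ ⋆ g′) n
  ⋆-cong ff gg zero    = *-cong (ff 0) (gg 0)
  ⋆-cong ff gg (suc n) = +-cong (*-cong (ff 0) (gg (suc n))) (⋆-cong (ff ∘ suc) gg n)

  ⋆-zeroˡ : ∀ g n → ((λ _ → 0#) ⋆ g) n ≈ 0#
  ⋆-zeroˡ g zero    = zeroˡ _
  ⋆-zeroˡ g (suc n) = transR (+-cong (zeroˡ _) (⋆-zeroˡ g n)) (+-identityˡ 0#)

  ⋆-identityˡ : ∀ {f} g → f 0 ≈ 1# → (∀ n → f (suc n) ≈ 0#) → ∀ n → (f ⋆ g) n ≈ g n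
  ⋆-identityˡ g f₀ f₊ zero    = transR (*-congʳ f₀) (*-identityˡ _)
  ⋆-identityˡ g f₀ f₊ (suc n) = transR
    (+-cong (transR (*-congʳ f₀) (*-identityˡ _)) (transR (⋆-cong f₊ (λ _ → reflR) n) (⋆-zeroˡ g n)))
    (+-identityʳ _)

  ⋆-distribʳ : ∀ g f f′ n → ((λ k → f k + f′ k) ⋆ g) n ≈ (f ⋆ g) n + (f′ ⋆ g) n
  ⋆-distribʳ g f f′ zero    = distribʳ _ _ _
  ⋆-distribʳ g f f′ (suc n) = transR (+-congˡ (⋆-distribʳ g (f ∘ suc) (f′ ∘ suc) n))
    (solve 5 (λ x y z u v → (x :+ y) :* z :+ (u :+ v) := (x :* z :+ u) :+ (y :* z :+ v)) reflR
      (f 0) (f′ 0) (g (suc n)) _ _)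

  ⋆-scale : ∀ x f g n → ((λ k → x * f k) ⋆ g) n ≈ x * (f ⋆ g) n
  ⋆-scale x f g zero    = *-assoc _ _ _
  ⋆-scale x f g (suc n) = transR (+-cong (*-assoc _ _ _) (⋆-scale x (f ∘ suc) g n)) (symR (distribˡ x _ _))

  -- The definition peels off the first value of `f`; peeling off that of `g` instead is what
  -- commutativity needs.
  ⋆-sucʳ : ∀ f g n → (f ⋆ g) (suc n) ≈ f (suc n) * g 0 + (f ⋆ (g ∘ suc)) n
  ⋆-sucʳ f g zero    = +-comm _ _
  ⋆-sucʳ f g (suc n) = transR (+-congˡ (⋆-sucʳ (f ∘ suc) g n))
    (solve 3 (λ x y z → x :+ (y :+ z) := y :+ (x :+ z)) reflR (f 0 * g (suc (suc n))) _ _)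

  ⋆-comm : ∀ f g n → (f ⋆ g) n ≈ (g ⋆ f) n
  ⋆-comm f g zero    = *-comm _ _
  ⋆-comm f g (suc n) = transR (+-cong (*-comm _ _) (⋆-comm (f ∘ suc) g n)) (symR (⋆-sucʳ g f n))

  ⋆-assoc : ∀ f g h n → ((f ⋆ g) ⋆ h) n ≈ (f ⋆ (g ⋆ h)) n
  ⋆-assoc f g h zero    = *-assoc _ _ _
  ⋆-assoc f g h (suc n) = begin
    f 0 * g 0 * h (suc n) + ((f ⋆ g) ∘ suc ⋆ h) n
      ≈⟨ +-congˡ (⋆-distribʳ h _ _ n) ⟩
    f 0 * g 0 * h (suc n) + (((λ k → f 0 * g (suc k)) ⋆ h) n + ((f ∘ suc ⋆ g) ⋆ h) n)
      ≈⟨ +-congˡ (+-cong (⋆-scale (f 0) (g ∘ suc) h n) (⋆-assoc (f ∘ suc) g h n)) ⟩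
    f 0 * g 0 * h (suc n) + (f 0 * (g ∘ suc ⋆ h) n + (f ∘ suc ⋆ (g ⋆ h)) n)
      ≈⟨ solve 5 (λ x y z u v → x :* y :* z :+ (x :* u :+ v) := x :* (y :* z :+ u) :+ v) reflR
           (f 0) (g 0) (h (suc n)) _ _ ⟩
    f 0 * (g 0 * h (suc n) + (g ∘ suc ⋆ h) n) + (f ∘ suc ⋆ (g ⋆ h)) n ∎

  -- Coefficients of a formal derivative. It serves for polynomials in t and for generating series
  -- in z of the powers of a letter.
  ∂ : Sequence → Sequence
  ∂ f n = suc n · f (suc n)

  -- A shift lowers the multiplier by one: `∂ f (suc k)` is `f (suc (suc k))` plus `∂ (f ∘ suc) k`.
  -- So one of the m + 2 copies of the tail is set aside as `f₁g`, and the induction hypothesis for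
  -- `f ∘ suc` takes the other m + 1.
  ∂-⋆ : ∀ f g n → ∂ (f ⋆ g) n ≈ (∂ f ⋆ g) n + (f ⋆ ∂ g) n
  ∂-⋆ f g zero    = solve 4 (λ x x′ y y′ →
    x :* y′ :+ x′ :* y :+ con 0 := (x′ :+ con 0) :* y :+ x :* (y′ :+ con 0)) reflR
    (f 0) (f 1) (g 0) (g 1)
  ∂-⋆ f g (suc m) = begin
    suc (suc m) · (f 0 * g (suc (suc m)) + (f ∘ suc ⋆ g) (suc m))
      ≈⟨ ×-distrib-+ _ _ (suc (suc m)) ⟩
    suc (suc m) · (f 0 * g (suc (suc m))) + (f₁g + suc m · (f ∘ suc ⋆ g) (suc m))
      ≈⟨ +-cong (symR (×-comm-* (suc (suc m)) _ _)) (+-congˡ (∂-⋆ (f ∘ suc) g m)) ⟩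
    f 0 * ∂ g (suc m) + (f₁g + ((∂ (f ∘ suc) ⋆ g) m + (f ∘ suc ⋆ ∂ g) m))
      ≈⟨ solve 6 (λ x y z u v w →
           z :+ ((x :* y :+ u) :+ (v :+ w)) := ((x :+ con 0) :* y :+ (u :+ v)) :+ (z :+ w)) reflR
           (f 1) (g (suc m)) (f 0 * ∂ g (suc m)) _ _ _ ⟩
    (∂ f 0 * g (suc m) + ((f ∘ suc ∘ suc ⋆ g) m + (∂ (f ∘ suc) ⋆ g) m)) + (f ⋆ ∂ g) (suc m)
      ≈⟨ +-congʳ (+-congˡ (symR (⋆-distribʳ g (f ∘ suc ∘ suc) (∂ (f ∘ suc)) m))) ⟩
    (∂ f ⋆ g) (suc m) + (f ⋆ ∂ g) (suc m) ∎
    where f₁g = (f ∘ suc ⋆ g) (suc m)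

-- The semiring of polynomials, division by factorials, and the derivative in t.

module Polynomials {a ℓ} (K : Field a ℓ) (char0 : CharacteristicZero K) where

  open Field K hiding (zero)
  open Over K char0
  open Convolution commutativeSemiring public

  -- A record, so that p and q can be inferred from a proof of p ≋ q.
  infix 4 _≋_
  record _≋_ (p q : K[t]) : Set ℓ where
    constructor mk≋
    field coeffs : p ≈ₚ q
  open _≋_ public

  coeff-* : ∀ p q n → coeff (p *ₚ q) n ≈ (coeff p ⋆ coeff q) n
  coeff-* []      q n       = symK (⋆-zeroˡ (coeff q) n)
  coeff-* (a ∷ p) q zero    =
    transK (coeff-+ (a • q) _ 0) (transK (+-cong (coeff-• a q 0) reflK) (+-identityʳ _))
  coeff-* (a ∷ p) q (suc n) =
    transK (coeff-+ (a • q) _ (suc n)) (+-cong (coeff-• a q (suc n)) (coeff-* p q n))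

  -- The laws are those of `⋆` read through `coeff`; packaged this way they make the ring solver
  -- available for polynomials.
  polynomialSemiring : CommutativeSemiring a ℓ
  polynomialSemiring = record
    { Carrier = K[t] ; _≈_ = _≋_ ; _+_ = _+ₚ_ ; _*_ = _*ₚ_ ; 0# = [] ; 1# = 1ₚ
    ; isCommutativeSemiring = isCommutativeSemiringˡ record
      { +-isCommutativeMonoid = record
        { isMonoid = record
          { isSemigroup = record
            { isMagma = record
              { isEquivalence = ≋-isEquivalence
              ; ∙-cong = λ {p} {p′} {q} {q′} pp qq → mk≋ λ n →
                  transK (coeff-+ p q n) (transK (+-cong (coeffs pp n) (coeffs qq n)) (symK (coeff-+ p′ q′ n)))
              }
            ; assoc = λ p q r → mk≋ λ n →
                transK (transK (coeff-+ (p +ₚ q) r n) (+-congʳ (coeff-+ p q n)))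
                  (transK (+-assoc _ _ _)
                    (symK (transK (coeff-+ p (q +ₚ r) n) (+-congˡ (coeff-+ q r n)))))
            }
          ; identity = (λ p → mk≋ λ n → reflK) , λ p → mk≋ λ n → transK (coeff-+ p [] n) (+-identityʳ _)
          }
        ; comm = λ p q → mk≋ λ n → transK (coeff-+ p q n) (transK (+-comm _ _) (symK (coeff-+ q p n)))
        }
      ; *-isCommutativeMonoid = record
        { isMonoid = record
          { isSemigroup = record
            { isMagma = record
              { isEquivalence = ≋-isEquivalence
              ; ∙-cong = λ {p} {p′} {q} {q′} pp qq → mk≋ λ n →
                  transK (coeff-* p q n) (transK (⋆-cong (coeffs pp) (coeffs qq) n) (symK (coeff-* p′ q′ n)))
              }
            ; assoc = λ p q r → mk≋ λ n →
                transK (transK (coeff-* (p *ₚ q) r n) (⋆-cong (coeff-* p q) (λ _ → reflK) n))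
                  (transK (⋆-assoc (coeff p) (coeff q) (coeff r) n)
                    (symK (transK (coeff-* p (q *ₚ r) n) (⋆-cong {f = coeff p} (λ _ → reflK) (coeff-* q r) n))))
            }
          ; identity = *ₚ-identityˡ , λ p → ≋-trans (*ₚ-comm p 1ₚ) (*ₚ-identityˡ p)
          }
        ; comm = *ₚ-comm
        }
      ; distribʳ = λ r p q → mk≋ λ n →
          transK (transK (coeff-* (p +ₚ q) r n) (⋆-cong (coeff-+ p q) (λ _ → reflK) n))
            (transK (⋆-distribʳ (coeff r) (coeff p) (coeff q) n)
              (symK (transK (coeff-+ (p *ₚ r) (q *ₚ r) n) (+-cong (coeff-* p r n) (coeff-* q r n)))))
      ; zeroˡ = λ p → mk≋ λ n → reflK
      }
    }
    where
    ≋-trans : ∀ {p q r} → p ≋ q → q ≋ r → p ≋ r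
    ≋-trans pq qr = mk≋ λ n → transK (coeffs pq n) (coeffs qr n)
    ≋-isEquivalence : IsEquivalence _≋_
    ≋-isEquivalence = record
      { refl = mk≋ λ n → reflK ; sym = λ pq → mk≋ λ n → symK (coeffs pq n) ; trans = ≋-trans }
    *ₚ-comm : ∀ p q → p *ₚ q ≋ q *ₚ p
    *ₚ-comm p q = mk≋ λ n →
      transK (coeff-* p q n) (transK (⋆-comm (coeff p) (coeff q) n) (symK (coeff-* q p n)))
    *ₚ-identityˡ : ∀ p → 1ₚ *ₚ p ≋ p
    *ₚ-identityˡ p = mk≋ λ n → transK (coeff-* 1ₚ p n) (⋆-identityˡ (coeff p) reflK (λ _ → reflK) n)

  module P = CommutativeSemiring polynomialSemiring
  module PS = SemiringSolver polynomialSemiring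
  open SemiringMult P.semiring public using ()
    renaming (_×_ to infixr 8 _·ₚ_; ×-comm-* to ·ₚ-comm-*; ×-assoc-* to ·ₚ-assoc-*; ×-assocˡ to ·ₚ-assocˡ;
              ×-congʳ to ·ₚ-congʳ)
  open SemiringMult semiring public using ()
    renaming (×-congʳ to ·-congʳ; ×1-homo-* to ·1-homo-*; ×-assoc-* to ·-assoc-*; ×-comm-* to ·-comm-*)

  ∷-cong : ∀ {x y p q} → x ≈ y → p ≋ q → x ∷ p ≋ y ∷ q
  ∷-cong x≈y p≋q = mk≋ λ where
    zero    → x≈y
    (suc n) → coeffs p≋q n

  •-congˡ : ∀ x {p q} → p ≋ q → x • p ≋ x • q
  •-congˡ x {p} {q} p≋q = mk≋ λ n →
    transK (coeff-• x p n) (transK (*-congˡ (coeffs p≋q n)) (symK (coeff-• x q n)))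

  0•-zero : ∀ {x} p → x ≈ 0# → x • p ≋ []
  0•-zero {x} p x≈0 = mk≋ λ n → transK (coeff-• x p n) (transK (*-congʳ x≈0) (zeroˡ _))

  •-congʳ : ∀ {x y} p → x ≈ y → x • p ≋ y • p
  •-congʳ {x} {y} p x≈y = mk≋ λ n →
    transK (coeff-• x p n) (transK (*-congʳ x≈y) (symK (coeff-• y p n)))

  •-assoc : ∀ x y p → (x * y) • p ≋ x • (y • p)
  •-assoc x y p = mk≋ λ n → transK (coeff-• (x * y) p n) (transK (*-assoc _ _ _)
    (symK (transK (coeff-• x (y • p) n) (*-congˡ (coeff-• y p n)))))

  •-const : ∀ x p → x • p ≋ const x *ₚ p
  •-const x p = mk≋ λ n → symK (transK (coeff-+ (x • p) (0# ∷ []) n) (transK (+-congˡ (zeros n)) (+-identityʳ _)))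
    where
    zeros : ∀ n → coeff (0# ∷ []) n ≈ 0#
    zeros zero    = reflK
    zeros (suc n) = reflK

  t*-shift : ∀ p → t *ₚ p ≋ 0# ∷ p
  t*-shift p = mk≋ λ n → transK (coeff-* t p n) (lemma n)
    where
    lemma : ∀ n → (coeff t ⋆ coeff p) n ≈ coeff (0# ∷ p) n
    lemma zero    = zeroˡ _
    lemma (suc n) = transK (+-cong (zeroˡ _) (⋆-identityˡ (coeff p) reflK (λ _ → reflK) n)) (+-identityˡ _)

  -- Multiplication by t shifts coefficients, so they reappear one place further on. This stands in
  -- for division by t after the junction rule.
  t*-cancelˡ : ∀ {p q} → t *ₚ p ≋ t *ₚ q → p ≋ q
  t*-cancelˡ {p} {q} tp≋tq = mk≋ λ n →
    coeffs (P.trans (P.sym (t*-shift p)) (P.trans tp≋tq (t*-shift q))) (suc n)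

  ·-zeroʳ : ∀ n → n · 0# ≈ 0#
  ·-zeroʳ zero    = reflK
  ·-zeroʳ (suc n) = transK (+-identityˡ _) (·-zeroʳ n)

  ·-as-* : ∀ n x → n · x ≈ (n · 1#) * x
  ·-as-* n x = transK (·-congʳ n (symK (*-identityˡ x))) (symK (·-assoc-* n 1# x))

  coeff-·ₚ : ∀ m p n → coeff (m ·ₚ p) n ≈ m · coeff p n
  coeff-·ₚ zero    p n = reflK
  coeff-·ₚ (suc m) p n = transK (coeff-+ p (m ·ₚ p) n) (+-congˡ (coeff-·ₚ m p n))

  n!•-inverse : ∀ n p → 1/ n ! • ((n !) ·ₚ p) ≋ p
  n!•-inverse n p = mk≋ λ k → begin
    coeff (1/ n ! • ((n !) ·ₚ p)) k   ≈⟨ coeff-• _ ((n !) ·ₚ p) k ⟩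
    1/ n ! * coeff ((n !) ·ₚ p) k     ≈⟨ *-congˡ (coeff-·ₚ (n !) p k) ⟩
    1/ n ! * ((n !) · coeff p k)      ≈⟨ ·-comm-* (n !) _ _ ⟩
    (n !) · (1/ n ! * coeff p k)      ≈⟨ ·-as-* (n !) _ ⟩
    ((n !) · 1#) * (1/ n ! * coeff p k) ≈⟨ *-assoc _ _ _ ⟨
    ((n !) · 1#) * 1/ n ! * coeff p k ≈⟨ *-congʳ (proj₂ (inverse ((n !) · 1#) (n!≉0 n))) ⟩
    1# * coeff p k                  ≈⟨ *-identityˡ _ ⟩
    coeff p k ∎
    where open SetoidReasoning setoid

  -- Horner form of the derivative: (x + t p)' = p + t p'.
  D : K[t] → K[t]
  D []      = []
  D (x ∷ p) = p +ₚ (0# ∷ D p)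

  coeff-D : ∀ p n → coeff (D p) n ≈ suc n · coeff p (suc n)
  coeff-D []      n       = symK (·-zeroʳ (suc n))
  coeff-D (x ∷ p) zero    = coeff-+ p (0# ∷ D p) 0
  coeff-D (x ∷ p) (suc n) = transK (coeff-+ p (0# ∷ D p) (suc n)) (+-congˡ (coeff-D p n))

  D-cong : ∀ {p q} → p ≋ q → D p ≋ D q
  D-cong {p} {q} p≋q = mk≋ λ n → transK (coeff-D p n)
    (transK (·-congʳ (suc n) (coeffs p≋q (suc n))) (symK (coeff-D q n)))

  D-+ : ∀ p q → D (p +ₚ q) ≋ D p +ₚ D q
  D-+ p q = mk≋ λ n → begin
    coeff (D (p +ₚ q)) n ≈⟨ coeff-D (p +ₚ q) n ⟩
    suc n · coeff (p +ₚ q) (suc n) ≈⟨ ·-congʳ (suc n) (coeff-+ p q (suc n)) ⟩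
    suc n · (coeff p (suc n) + coeff q (suc n)) ≈⟨ ×-distrib-+ _ _ (suc n) ⟩
    suc n · coeff p (suc n) + suc n · coeff q (suc n) ≈⟨ +-cong (coeff-D p n) (coeff-D q n) ⟨
    coeff (D p) n + coeff (D q) n ≈⟨ coeff-+ (D p) (D q) n ⟨
    coeff (D p +ₚ D q) n ∎
    where
    open SetoidReasoning setoid
    open CommutativeMonoidMult +-commutativeMonoid using (×-distrib-+)

  D-* : ∀ p q → D (p *ₚ q) ≋ D p *ₚ q +ₚ p *ₚ D q
  D-* p q = mk≋ λ n → begin
    coeff (D (p *ₚ q)) n ≈⟨ coeff-D (p *ₚ q) n ⟩
    suc n · coeff (p *ₚ q) (suc n) ≈⟨ ·-congʳ (suc n) (coeff-* p q (suc n)) ⟩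
    ∂ (coeff p ⋆ coeff q) n ≈⟨ ∂-⋆ (coeff p) (coeff q) n ⟩
    (∂ (coeff p) ⋆ coeff q) n + (coeff p ⋆ ∂ (coeff q)) n
      ≈⟨ +-cong (⋆-cong (coeff-D p) (λ _ → reflK) n) (⋆-cong {f = coeff p} (λ _ → reflK) (coeff-D q) n) ⟨
    (coeff (D p) ⋆ coeff q) n + (coeff p ⋆ coeff (D q)) n
      ≈⟨ +-cong (coeff-* (D p) q n) (coeff-* p (D q) n) ⟨
    coeff (D p *ₚ q) n + coeff (p *ₚ D q) n ≈⟨ coeff-+ (D p *ₚ q) (p *ₚ D q) n ⟨
    coeff (D p *ₚ q +ₚ p *ₚ D q) n ∎
    where open SetoidReasoning setoid

-- Finite sums and products, the maps `ℱ` as linear functionals, and Pascal's rule.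

module BinomialBasis {a ℓ} (K : Field a ℓ) (char0 : CharacteristicZero K) where

  open Field K hiding (zero)
  open Over K char0
  open Polynomials K char0

  module KS = SemiringSolver commutativeSemiring

  ∑-upTo-suc : ∀ m (f : ℕ → Carrier) → ∑ (upTo (suc m)) f ≡ f 0 + ∑ (upTo m) (f ∘ suc)
  ∑-upTo-suc m f = cong (f 0 +_)
    (trans (cong (λ l → ∑ l f) (sym (map-upTo suc m))) (∑-map suc (upTo m) f))

  ∑-++ : ∀ {i} {I : Set i} (xs ys : List I) (f : I → Carrier) → ∑ (xs ++ ys) f ≈ ∑ xs f + ∑ ys f
  ∑-++ []       ys f = symK (+-identityˡ _)
  ∑-++ (x ∷ xs) ys f = transK (+-congˡ (∑-++ xs ys f)) (symK (+-assoc _ _ _))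

  ∑-*ˡ : ∀ {i} {I : Set i} (xs : List I) x (f : I → Carrier) → ∑ xs (λ y → x * f y) ≈ x * ∑ xs f
  ∑-*ˡ []       x f = symK (zeroʳ x)
  ∑-*ˡ (y ∷ xs) x f = transK (+-congˡ (∑-*ˡ xs x f)) (symK (distribˡ x _ _))

  ∏-map : ∀ {i j} {I : Set i} {J : Set j} (φ : I → J) xs (f : J → K[t]) → ∏ₚ (map φ xs) f ≡ ∏ₚ xs (f ∘ φ)
  ∏-map φ []       f = refl
  ∏-map φ (x ∷ xs) f = cong (f (φ x) *ₚ_) (∏-map φ xs f)

  ∏-cong : ∀ {i} {I : Set i} (xs : List I) {f f′ : I → K[t]} → (∀ x → f x ≋ f′ x) → ∏ₚ xs f ≋ ∏ₚ xs f′
  ∏-cong []       ff = P.refl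
  ∏-cong (x ∷ xs) ff = P.*-cong (ff x) (∏-cong xs ff)

  ∏-upTo-suc : ∀ m (f : ℕ → K[t]) → ∏ₚ (upTo (suc m)) f ≡ f 0 *ₚ ∏ₚ (upTo m) (f ∘ suc)
  ∏-upTo-suc m f = cong (f 0 *ₚ_)
    (trans (cong (λ l → ∏ₚ l f) (sym (map-upTo suc m))) (∏-map suc (upTo m) f))

  ∏-∷ʳ : ∀ {i} {I : Set i} (xs : List I) x (f : I → K[t]) → ∏ₚ (xs ++ [ x ]) f ≋ ∏ₚ xs f *ₚ f x
  ∏-∷ʳ []       x f = P.*-comm (f x) 1ₚ
  ∏-∷ʳ (y ∷ xs) x f = P.trans (P.*-congˡ {f y} (∏-∷ʳ xs x f)) (P.sym (P.*-assoc (f y) (∏ₚ xs f) (f x)))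

  ∑ₚ-map : ∀ {i j} {I : Set i} {J : Set j} (φ : I → J) xs (f : J → K[t]) → ∑ₚ (map φ xs) f ≡ ∑ₚ xs (f ∘ φ)
  ∑ₚ-map φ []       f = refl
  ∑ₚ-map φ (x ∷ xs) f = cong (f (φ x) +ₚ_) (∑ₚ-map φ xs f)

  ∑ₚ-++ : ∀ {i} {I : Set i} (xs ys : List I) (f : I → K[t]) → ∑ₚ (xs ++ ys) f ≋ ∑ₚ xs f +ₚ ∑ₚ ys f
  ∑ₚ-++ []       ys f = P.refl
  ∑ₚ-++ (x ∷ xs) ys f = P.trans (P.+-congˡ {f x} (∑ₚ-++ xs ys f)) (P.sym (P.+-assoc (f x) _ _))

  ∑ₚ-cong : ∀ {i} {I : Set i} (xs : List I) {f f′ : I → K[t]} → (∀ {x} → x ∈ xs → f x ≋ f′ x) → ∑ₚ xs f ≋ ∑ₚ xs f′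
  ∑ₚ-cong []       ff = P.refl
  ∑ₚ-cong (x ∷ xs) ff = P.+-cong (ff (here refl)) (∑ₚ-cong xs (ff ∘ there))

  ∑ₚ-*ˡ : ∀ {i} {I : Set i} (xs : List I) p (f : I → K[t]) → ∑ₚ xs (λ x → p *ₚ f x) ≋ p *ₚ ∑ₚ xs f
  ∑ₚ-*ˡ []       p f = P.sym (P.zeroʳ p)
  ∑ₚ-*ˡ (x ∷ xs) p f = P.trans (P.+-congˡ {p *ₚ f x} (∑ₚ-*ˡ xs p f)) (P.sym (P.distribˡ p (f x) _))

  ∑ₚ-•ˡ : ∀ {i} {I : Set i} (xs : List I) x (f : I → K[t]) → ∑ₚ xs (λ y → x • f y) ≋ const x *ₚ ∑ₚ xs f
  ∑ₚ-•ˡ xs x f = P.trans (∑ₚ-cong xs λ {y} _ → •-const x (f y)) (∑ₚ-*ˡ xs (const x) f)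

  ∑ₚ-concatMap : ∀ {i j} {I : Set i} {J : Set j} (φ : I → List J) xs (f : J → K[t]) →
    ∑ₚ (concatMap φ xs) f ≋ ∑ₚ xs (λ x → ∑ₚ (φ x) f)
  ∑ₚ-concatMap φ []       f = P.refl
  ∑ₚ-concatMap φ (x ∷ xs) f = P.trans (∑ₚ-++ (φ x) _ f) (P.+-congˡ {∑ₚ (φ x) f} (∑ₚ-concatMap φ xs f))

  D-∑ : ∀ {i} {I : Set i} (xs : List I) (f : I → K[t]) → D (∑ₚ xs f) ≋ ∑ₚ xs (D ∘ f)
  D-∑ []       f = P.refl
  D-∑ (x ∷ xs) f = P.trans (D-+ (f x) (∑ₚ xs f)) (P.+-congˡ {D (f x)} (D-∑ xs f))

  D-·ₚ : ∀ m p → D (m ·ₚ p) ≋ m ·ₚ D p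
  D-·ₚ zero    p = P.refl
  D-·ₚ (suc m) p = P.trans (D-+ p (m ·ₚ p)) (P.+-congˡ {D p} (D-·ₚ m p))

  -- The value at q of the linear functional taking t^k to f k.
  ⟨_,_⟩ : K[t] → (ℕ → Carrier) → Carrier
  ⟨ []    , f ⟩ = 0#
  ⟨ x ∷ q , f ⟩ = x * f 0 + ⟨ q , f ∘ suc ⟩

  ⟨⟩-≈0 : ∀ {q} → [] ≋ q → ∀ f → 0# ≈ ⟨ q , f ⟩
  ⟨⟩-≈0 {[]}    _   f = reflK
  ⟨⟩-≈0 {x ∷ q} 0≋q f = symK (transK
    (+-cong (transK (*-congʳ (symK (coeffs 0≋q 0))) (zeroˡ _)) (symK (⟨⟩-≈0 {q} (mk≋ (coeffs 0≋q ∘ suc)) (f ∘ suc))))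
    (+-identityʳ _))

  -- Lists equal under `≋` may differ in length by trailing zeros, and `ℱ` sums over the length.
  -- Recursion on both lists, with `⟨⟩-≈0` for the surplus, makes `ℱ` well defined on polynomials.
  ⟨⟩-congˡ : ∀ {p q} → p ≋ q → ∀ f → ⟨ p , f ⟩ ≈ ⟨ q , f ⟩
  ⟨⟩-congˡ {[]}    {q}     p≋q f = ⟨⟩-≈0 p≋q f
  ⟨⟩-congˡ {x ∷ p} {[]}    p≋q f = symK (⟨⟩-≈0 (P.sym p≋q) f)
  ⟨⟩-congˡ {x ∷ p} {y ∷ q} p≋q f =
    +-cong (*-congʳ (coeffs p≋q 0)) (⟨⟩-congˡ {p} {q} (mk≋ (coeffs p≋q ∘ suc)) (f ∘ suc))

  ⟨⟩-congʳ : ∀ q {f f′} → (∀ k → f k ≈ f′ k) → ⟨ q , f ⟩ ≈ ⟨ q , f′ ⟩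
  ⟨⟩-congʳ []      ff = reflK
  ⟨⟩-congʳ (x ∷ q) ff = +-cong (*-congˡ (ff 0)) (⟨⟩-congʳ q (ff ∘ suc))

  ⟨⟩-+ˡ : ∀ p q f → ⟨ p +ₚ q , f ⟩ ≈ ⟨ p , f ⟩ + ⟨ q , f ⟩
  ⟨⟩-+ˡ []      q       f = symK (+-identityˡ _)
  ⟨⟩-+ˡ (x ∷ p) []      f = symK (+-identityʳ _)
  ⟨⟩-+ˡ (x ∷ p) (y ∷ q) f = transK (+-congˡ (⟨⟩-+ˡ p q (f ∘ suc)))
    (KS.solve 5 (λ x y z u v → let open KS in (x :+ y) :* z :+ (u :+ v) := (x :* z :+ u) :+ (y :* z :+ v)) reflK
      x y (f 0) _ _)

  ⟨⟩-+ʳ : ∀ q f f′ → ⟨ q , (λ k → f k + f′ k) ⟩ ≈ ⟨ q , f ⟩ + ⟨ q , f′ ⟩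
  ⟨⟩-+ʳ []      f f′ = symK (+-identityˡ _)
  ⟨⟩-+ʳ (x ∷ q) f f′ = transK (+-congˡ (⟨⟩-+ʳ q (f ∘ suc) (f′ ∘ suc)))
    (KS.solve 5 (λ z x y u v → let open KS in z :* (x :+ y) :+ (u :+ v) := (z :* x :+ u) :+ (z :* y :+ v)) reflK
      x (f 0) (f′ 0) _ _)

  ⟨⟩-t* : ∀ q f → ⟨ t *ₚ q , f ⟩ ≈ ⟨ q , f ∘ suc ⟩
  ⟨⟩-t* q f = transK (⟨⟩-congˡ (t*-shift q) f) (transK (+-congʳ (zeroˡ _)) (+-identityˡ _))

  ⟨⟩-∑ : ∀ q f → ∑ (upTo (length q)) (λ k → coeff q k * f k) ≈ ⟨ q , f ⟩
  ⟨⟩-∑ []      f = reflK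
  ⟨⟩-∑ (x ∷ q) f = transK (reflexive (∑-upTo-suc (length q) (λ k → coeff (x ∷ q) k * f k)))
                          (+-congˡ (⟨⟩-∑ q (f ∘ suc)))

  binomialCoeff : ℕ → ℕ → ℕ → Carrier
  binomialCoeff p n k = coeff (binomial p k) n

  coeff-ℱ : ∀ p q n → coeff (ℱ p q) n ≈ ⟨ q , binomialCoeff p n ⟩
  coeff-ℱ p q n = transK (coeff-∑ (upTo (length q)) (coeff q) (binomial p) n) (⟨⟩-∑ q (binomialCoeff p n))

  ℱ-cong : ∀ p {q q′} → q ≋ q′ → ℱ p q ≋ ℱ p q′
  ℱ-cong p {q} {q′} q≋q′ = mk≋ λ n →
    transK (coeff-ℱ p q n) (transK (⟨⟩-congˡ q≋q′ _) (symK (coeff-ℱ p q′ n)))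

  -- Each `1/ n !` is known only through its defining equation, so the recursion comes from (k+1)! =
  -- (k+1) k! after inserting k! times its inverse.
  1/suc! : ∀ k → 1/ suc k ! * (suc k · 1#) ≈ 1/ k !
  1/suc! k = begin
    1/ suc k ! * (suc k · 1#) ≈⟨ *-identityʳ _ ⟨
    1/ suc k ! * (suc k · 1#) * 1# ≈⟨ *-congˡ (proj₂ (inverse ((k !) · 1#) (n!≉0 k))) ⟨
    1/ suc k ! * (suc k · 1#) * (((k !) · 1#) * 1/ k !)
      ≈⟨ KS.solve 4 (λ x y z w → let open KS in x :* y :* (z :* w) := ((y :* z) :* x) :* w) reflK _ _ _ _ ⟩
    (suc k · 1#) * ((k !) · 1#) * 1/ suc k ! * 1/ k !
      ≈⟨ *-congʳ (*-congʳ (·1-homo-* (suc k) (k !))) ⟨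
    ((suc k !) · 1#) * 1/ suc k ! * 1/ k !
      ≈⟨ *-congʳ (proj₂ (inverse ((suc k !) · 1#) (n!≉0 (suc k)))) ⟩
    1# * 1/ k ! ≈⟨ *-identityˡ _ ⟩
    1/ k ! ∎
    where open SetoidReasoning setoid

  fallingFactorial : ℕ → ℕ → K[t]
  fallingFactorial p k = ∏ₚ (upTo k) (λ i → t +ₚ const (p · 1# - i · 1#))

  -- All factors on the left but the first are those of `fallingFactorial p k`. The first, t + p +
  -- 1, is (t + p - k) + (k + 1), and t + p - k is the last factor of `fallingFactorial p (suc k)`.
  fallingFactorial-suc : ∀ p k →
    fallingFactorial (suc p) (suc k) ≋ fallingFactorial p (suc k) +ₚ const (suc k · 1#) *ₚ fallingFactorial p k
  fallingFactorial-suc p k = begin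
    fallingFactorial (suc p) (suc k)
      ≡⟨ ∏-upTo-suc k (λ i → t +ₚ const (suc p · 1# - i · 1#)) ⟩
    (t +ₚ const (suc p · 1# - 0#)) *ₚ ∏ₚ (upTo k) (λ i → t +ₚ const (suc p · 1# - suc i · 1#))
      ≈⟨ P.*-cong (P.+-congˡ {t} (const-cong head-factor)) (∏-cong (upTo k) λ i → P.+-congˡ {t} (const-cong (cancel i))) ⟩
    (t +ₚ const (p · 1# - k · 1# + suc k · 1#)) *ₚ fallingFactorial p k
      ≈⟨ PS.solve 4 (λ x y z w → let open PS in (x :+ (y :+ z)) :* w := w :* (x :+ y) :+ z :* w) P.refl
           t (const (p · 1# - k · 1#)) (const (suc k · 1#)) (fallingFactorial p k) ⟩
    fallingFactorial p k *ₚ (t +ₚ const (p · 1# - k · 1#)) +ₚ const (suc k · 1#) *ₚ fallingFactorial p k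
      ≈⟨ P.+-congʳ (∏-∷ʳ (upTo k) k _) ⟨
    ∏ₚ (upTo k ++ [ k ]) (λ i → t +ₚ const (p · 1# - i · 1#)) +ₚ const (suc k · 1#) *ₚ fallingFactorial p k
      ≡⟨ cong (λ l → ∏ₚ l (λ i → t +ₚ const (p · 1# - i · 1#)) +ₚ const (suc k · 1#) *ₚ fallingFactorial p k) (upTo-∷ʳ k) ⟩
    fallingFactorial p (suc k) +ₚ const (suc k · 1#) *ₚ fallingFactorial p k ∎
    where
    open SetoidReasoning P.setoid
    open AbelianGroupProperties +-abelianGroup using (⁻¹-∙-comm)
    open RingProperties ring using (-0#≈0#)
    const-cong : ∀ {x y} → x ≈ y → const x ≋ const y
    const-cong x≈y = ∷-cong x≈y P.refl
    head-factor : suc p · 1# - 0# ≈ p · 1# - k · 1# + suc k · 1#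
    head-factor = transK (transK (+-congˡ -0#≈0#) (+-identityʳ _)) (symK (transK
      (KS.solve 4 (λ x y z o → let open KS in (x :+ y) :+ (o :+ z) := (o :+ x) :+ (z :+ y)) reflK
        (p · 1#) (- (k · 1#)) (k · 1#) 1#)
      (transK (+-congˡ (-‿inverseʳ _)) (+-identityʳ _))))
    cancel : ∀ i → suc p · 1# - suc i · 1# ≈ p · 1# - i · 1#
    cancel i = transK (+-congˡ (symK (⁻¹-∙-comm 1# (i · 1#))))
      (transK (KS.solve 4 (λ x y z o → let open KS in (o :+ x) :+ (y :+ z) := (o :+ y) :+ (x :+ z)) reflK
                (p · 1#) (- 1#) (- (i · 1#)) 1#)
              (transK (+-congʳ (-‿inverseʳ 1#)) (+-identityˡ _)))

  pascal : ∀ p k → binomial (suc p) (suc k) ≋ binomial p (suc k) +ₚ binomial p k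
  pascal p k = mk≋ λ n → begin
    coeff (binomial (suc p) (suc k)) n
      ≈⟨ coeff-• _ (F (suc p) (suc k)) n ⟩
    1/ suc k ! * coeff (F (suc p) (suc k)) n
      ≈⟨ *-congˡ (coeffs (fallingFactorial-suc p k) n) ⟩
    1/ suc k ! * coeff (F p (suc k) +ₚ const (suc k · 1#) *ₚ F p k) n
      ≈⟨ *-congˡ (transK (coeff-+ (F p (suc k)) _ n)
           (+-congˡ (transK (symK (coeffs (•-const (suc k · 1#) (F p k)) n)) (coeff-• _ (F p k) n)))) ⟩
    1/ suc k ! * (coeff (F p (suc k)) n + (suc k · 1#) * coeff (F p k) n)
      ≈⟨ KS.solve 4 (λ x y z w → let open KS in x :* (y :+ z :* w) := x :* y :+ x :* z :* w) reflK _ _ _ _ ⟩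
    1/ suc k ! * coeff (F p (suc k)) n + 1/ suc k ! * (suc k · 1#) * coeff (F p k) n
      ≈⟨ +-congˡ (*-congʳ (1/suc! k)) ⟩
    1/ suc k ! * coeff (F p (suc k)) n + 1/ k ! * coeff (F p k) n
      ≈⟨ +-cong (coeff-• _ (F p (suc k)) n) (coeff-• _ (F p k) n) ⟨
    coeff (binomial p (suc k)) n + coeff (binomial p k) n
      ≈⟨ coeff-+ (binomial p (suc k)) (binomial p k) n ⟨
    coeff (binomial p (suc k) +ₚ binomial p k) n ∎
    where
    open SetoidReasoning setoid
    F = fallingFactorial

  -- By Pascal's rule the functional for p + 1 takes on t r the value that the functional for p
  -- takes on (t+1) r. Lowering p by one thus trades one factor t for t + 1.
  ⟨⟩-binomial : ∀ p q n →
    ⟨ t ^ₚ p *ₚ q , binomialCoeff p n ⟩ ≈ ⟨ (t +ₚ 1ₚ) ^ₚ p *ₚ q , binomialCoeff 0 n ⟩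
  ⟨⟩-binomial zero    q n = reflK
  ⟨⟩-binomial (suc p) q n = begin
    ⟨ t ^ₚ suc p *ₚ q , β (suc p) ⟩
      ≈⟨ ⟨⟩-congˡ (P.*-assoc t (t ^ₚ p) q) _ ⟩
    ⟨ t *ₚ r , β (suc p) ⟩
      ≈⟨ ⟨⟩-t* r (β (suc p)) ⟩
    ⟨ r , β (suc p) ∘ suc ⟩
      ≈⟨ ⟨⟩-congʳ r (λ k → transK (coeffs (pascal p k) n) (coeff-+ (binomial p (suc k)) (binomial p k) n)) ⟩
    ⟨ r , (λ k → β p (suc k) + β p k) ⟩
      ≈⟨ ⟨⟩-+ʳ r (β p ∘ suc) (β p) ⟩
    ⟨ r , β p ∘ suc ⟩ + ⟨ r , β p ⟩
      ≈⟨ +-congʳ (⟨⟩-t* r (β p)) ⟨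
    ⟨ t *ₚ r , β p ⟩ + ⟨ r , β p ⟩
      ≈⟨ ⟨⟩-+ˡ (t *ₚ r) r (β p) ⟨
    ⟨ t *ₚ r +ₚ r , β p ⟩
      -- The new factor t + 1 is moved into the arbitrary polynomial, so that the induction
      -- hypothesis applies to `(t +ₚ 1ₚ) *ₚ q`.
      ≈⟨ ⟨⟩-congˡ (PS.solve 3 (λ x y z → let open PS in x :* (y :* z) :+ y :* z := y :* ((x :+ con 1) :* z)) P.refl t (t ^ₚ p) q) _ ⟩
    ⟨ t ^ₚ p *ₚ ((t +ₚ 1ₚ) *ₚ q) , β p ⟩
      ≈⟨ ⟨⟩-binomial p ((t +ₚ 1ₚ) *ₚ q) n ⟩
    ⟨ (t +ₚ 1ₚ) ^ₚ p *ₚ ((t +ₚ 1ₚ) *ₚ q) , β 0 ⟩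
      ≈⟨ ⟨⟩-congˡ (PS.solve 3 (λ x y z → let open PS in y :* (x :* z) := x :* y :* z) P.refl (t +ₚ 1ₚ) ((t +ₚ 1ₚ) ^ₚ p) q) _ ⟩
    ⟨ (t +ₚ 1ₚ) ^ₚ suc p *ₚ q , β 0 ⟩ ∎
    where
    open SetoidReasoning setoid
    β : ℕ → ℕ → Carrier
    β p = binomialCoeff p n
    r = t ^ₚ p *ₚ q

  ℱ-t^ : ∀ p q → ℱ p (t ^ₚ p *ₚ q) ≋ ℱ 0 ((t +ₚ 1ₚ) ^ₚ p *ₚ q)
  ℱ-t^ p q = mk≋ λ n → transK (coeff-ℱ p (t ^ₚ p *ₚ q) n)
    (transK (⟨⟩-binomial p q n) (symK (coeff-ℱ 0 ((t +ₚ 1ₚ) ^ₚ p *ₚ q) n)))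

-- Coefficients of `g` at ascents and descents, and the junction rule for `H`.

module Junctions {a ℓ} (K : Field a ℓ) (char0 : CharacteristicZero K) where

  open Field K hiding (zero)
  open Over K char0
  open Polynomials K char0
  open BinomialBasis K char0

  -- A cut lies to the left or to the right of the marked letter `b`. Without a marked letter the
  -- cut between `p` and `q` would belong to both kinds.
  splits-++-∷ : ∀ p b q → splits (p ++ b ∷ q) ≡
    map (Prod.map₂ (_++ b ∷ q)) (splits p) ++ map (Prod.map₁ (λ u → p ++ b ∷ u)) (splits q)
  splits-++-∷ []      b q = refl
  splits-++-∷ (x ∷ p) b q = cong (([] , x ∷ p ++ b ∷ q) ∷_)
    (trans (cong (map (Prod.map₁ (x ∷_))) (splits-++-∷ p b q))
      (trans (map-++ _ (map _ (splits p)) _)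
        (cong₂ _++_ (trans (sym (map-∘ (splits p))) (map-∘ (splits p))) (sym (map-∘ (splits q))))))

  ∑-splits-∷ : ∀ x w (f : Word × Word → Carrier) →
    ∑ (splits (x ∷ w)) f ≡ f ([] , x ∷ w) + ∑ (splits w) (f ∘ Prod.map₁ (x ∷_))
  ∑-splits-∷ x w f = cong (f ([] , x ∷ w) +_) (∑-map (Prod.map₁ (x ∷_)) (splits w) f)

  exp-∈ : ∀ {N x w} → x ∈ w → x ≢ N → exp N w ≈ 0#
  exp-∈ {N} {x} {w} x∈w x≢N = if-no (all? (_≟ N) w) (λ all → x≢N (All.lookup all x∈w))

  -- The part taken by `exp N` consists of letters `N` only, so the cut must lie to the right of
  -- `b`.
  *-exp-split : ∀ f {N b} p q → b ≢ N →
    (f *ₛ exp N) (p ++ b ∷ q) ≈ ∑ (splits q) (λ (u , v) → f (p ++ b ∷ u) * exp N v)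
  *-exp-split f {N} {b} p q b≢N = begin
    ∑ (splits (p ++ b ∷ q)) F
      ≡⟨ cong (λ l → ∑ l F) (splits-++-∷ p b q) ⟩
    ∑ (map (Prod.map₂ (_++ b ∷ q)) (splits p) ++ map (Prod.map₁ (λ u → p ++ b ∷ u)) (splits q)) F
      ≈⟨ ∑-++ (map _ (splits p)) _ F ⟩
    ∑ (map (Prod.map₂ (_++ b ∷ q)) (splits p)) F + ∑ (map (Prod.map₁ (λ u → p ++ b ∷ u)) (splits q)) F
      ≡⟨ cong₂ _+_ (∑-map _ (splits p) F) (∑-map _ (splits q) F) ⟩
    ∑ (splits p) (λ (u , v) → f u * exp N (v ++ b ∷ q)) + ∑ (splits q) (λ (u , v) → f (p ++ b ∷ u) * exp N v)
      ≈⟨ +-congʳ (∑-zero (splits p) λ {(u , v)} _ →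
           transK (*-congˡ (exp-∈ (∈-++⁺ʳ v (here refl)) b≢N)) (zeroʳ _)) ⟩
    0# + ∑ (splits q) (λ (u , v) → f (p ++ b ∷ u) * exp N v)
      ≈⟨ +-identityˡ _ ⟩
    ∑ (splits q) (λ (u , v) → f (p ++ b ∷ u) * exp N v) ∎
    where
    open SetoidReasoning setoid
    F : Word × Word → Carrier
    F (u , v) = f u * exp N v

  partialProduct-∈ : ∀ {N x w} → N ≤ x → x ∈ w → partialProduct N w ≈ 0#
  partialProduct-∈ {zero}  {w = _ ∷ _} _   _   = reflK
  partialProduct-∈ {suc N} {x} {w}     N<x x∈w = ∑-zero (splits w) term
    where
    term : ∀ {uv} → uv ∈ splits w → partialProduct N (proj₁ uv) * exp N (proj₂ uv) ≈ 0#
    term {u , v} uv∈ with ∈-++⁻ u (subst (x ∈_) (sym (splits-++ w uv∈)) x∈w)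
    ... | inj₁ x∈u = transK (*-congʳ (partialProduct-∈ (ℕₚ.<⇒≤ N<x) x∈u)) (zeroˡ _)
    ... | inj₂ x∈v = transK (*-congˡ (exp-∈ x∈v (λ x≡N → ℕₚ.<⇒≢ N<x (sym x≡N)))) (zeroʳ _)

  partialProduct-[] : ∀ N → partialProduct N [] ≈ 1#
  partialProduct-[] zero    = reflK
  partialProduct-[] (suc N) = transK (+-identityʳ _)
    (transK (*-cong (partialProduct-[] N) 1/0!≈1) (*-identityˡ _))

  -- If `c` is not among the first letters, both sides vanish. Otherwise `b` lies strictly below the
  -- last letter, so the last exponential takes a suffix of `c ∷ q` on either side, and the
  -- induction hypothesis separates what is left.
  partialProduct-ascent : ∀ N {b c} → b < c → ∀ p q →
    partialProduct N (p ++ b ∷ c ∷ q) ≈ partialProduct N (p ++ [ b ]) * partialProduct N (c ∷ q)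
  partialProduct-ascent N {b} {c} b<c p q with N ≤? c
  ... | yes N≤c = transK (partialProduct-∈ N≤c (∈-++⁺ʳ p (there (here refl))))
    (symK (transK (*-congˡ (partialProduct-∈ N≤c (here refl))) (zeroʳ _)))
  partialProduct-ascent zero    _ _ _   | no N≰c = ⊥-elim (N≰c z≤n)
  partialProduct-ascent (suc N) {b} {c} b<c p q | no N≰c = begin
    partialProduct (suc N) (p ++ b ∷ c ∷ q)
      ≈⟨ *-exp-split PP p (c ∷ q) b≢N ⟩
    ∑ (splits (c ∷ q)) (λ (u , v) → PP (p ++ b ∷ u) * exp N v)
      ≡⟨ ∑-splits-∷ c q (λ (u , v) → PP (p ++ b ∷ u) * exp N v) ⟩
    PP (p ++ [ b ]) * exp N (c ∷ q) + ∑ (splits q) (λ (u , v) → PP (p ++ b ∷ c ∷ u) * exp N v)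
      -- A factor `PP []`, equal to 1, is inserted: it turns the first term into the split of
      -- `c ∷ q` with empty left part, which the sum over `splits q` lacks.
      ≈⟨ +-cong (*-congˡ (transK (symK (*-identityˡ _)) (*-congʳ (symK (partialProduct-[] N)))))
           (transK (∑-cong (splits q) (λ {(u , v)} _ →
                     transK (*-congʳ (partialProduct-ascent N b<c p u)) (*-assoc _ _ _)))
                   (∑-*ˡ (splits q) _ _)) ⟩
    PP (p ++ [ b ]) * (PP [] * exp N (c ∷ q)) + PP (p ++ [ b ]) * ∑ (splits q) (λ (u , v) → PP (c ∷ u) * exp N v)
      ≈⟨ distribˡ _ _ _ ⟨
    PP (p ++ [ b ]) * (PP [] * exp N (c ∷ q) + ∑ (splits q) (λ (u , v) → PP (c ∷ u) * exp N v))
      ≡⟨ cong (PP (p ++ [ b ]) *_) (∑-splits-∷ c q (λ (u , v) → PP u * exp N v)) ⟨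
    PP (p ++ [ b ]) * partialProduct (suc N) (c ∷ q)
      ≈⟨ *-congʳ (transK (*-exp-split PP p [] b≢N)
           (transK (+-identityʳ _) (transK (*-congˡ 1/0!≈1) (*-identityʳ _)))) ⟨
    partialProduct (suc N) (p ++ [ b ]) * partialProduct (suc N) (c ∷ q) ∎
    where
    open SetoidReasoning setoid
    PP = partialProduct N
    b≢N : b ≢ N
    b≢N b≡N = N≰c (subst (_< c) b≡N b<c)

  -- Here `c` is the marked letter. It lies below the last letter, so the last exponential starts to
  -- the right of it and the pair `b`, `c` stays together in the smaller product.
  partialProduct-descent : ∀ N {b c} → c < b → ∀ p q → partialProduct N (p ++ b ∷ c ∷ q) ≈ 0#
  partialProduct-descent N {b} {c} c<b p q with N ≤? b
  ... | yes N≤b = partialProduct-∈ N≤b (∈-++⁺ʳ p (here refl))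
  partialProduct-descent zero    _ _ _ | no N≰b = ⊥-elim (N≰b z≤n)
  partialProduct-descent (suc N) {b} {c} c<b p q | no N≰b =
    transK (reflexive (cong (partialProduct (suc N)) (sym (++-assoc p [ b ] (c ∷ q)))))
      (transK (*-exp-split (partialProduct N) (p ++ [ b ]) q (ℕₚ.<⇒≢ (ℕₚ.<-≤-trans c<b (ℕₚ.≤-pred (ℕₚ.≰⇒> N≰b)))))
        (∑-zero (splits q) λ {(u , v)} _ → transK (*-congʳ
          (transK (reflexive (cong (partialProduct N) (++-assoc p [ b ] (c ∷ u)))) (partialProduct-descent N c<b p u)))
          (zeroˡ _)))

  bound-least : ∀ w {N} → (∀ {x} → x ∈ w → x < N) → bound w ≤ N
  bound-least []      _  = z≤n
  bound-least (x ∷ w) w< = ℕₚ.⊔-lub (w< (here refl)) (bound-least w (w< ∘ there))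

  -- `g` evaluates each of the three words at its own bound; stability moves the two shorter ones to
  -- the bound of the whole word.
  g-ascent : ∀ {b c} → b < c → ∀ p q → g (p ++ b ∷ c ∷ q) ≈ g (p ++ [ b ]) * g (c ∷ q)
  g-ascent {b} {c} b<c p q = transK (partialProduct-ascent N b<c p q)
    (*-cong (partialProduct-stable (p ++ [ b ]) (bound-least (p ++ [ b ]) (∈-bound ∘ left)))
            (partialProduct-stable (c ∷ q) (bound-least (c ∷ q) (∈-bound ∘ ∈-++⁺ʳ p ∘ there))))
    where
    N = bound (p ++ b ∷ c ∷ q)
    left : ∀ {x} → x ∈ p ++ [ b ] → x ∈ p ++ b ∷ c ∷ q
    left x∈ with ∈-++⁻ p x∈
    ... | inj₁ x∈p         = ∈-++⁺ˡ x∈p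
    ... | inj₂ (here x≡b) = ∈-++⁺ʳ p (here x≡b)

  g-descent : ∀ {b c} → c < b → ∀ p q → g (p ++ b ∷ c ∷ q) ≈ 0#
  g-descent {b} {c} c<b p q = partialProduct-descent (bound (p ++ b ∷ c ∷ q)) c<b p q

  g-replicate : ∀ n x → g (replicate n x) ≈ 1/ n !
  g-replicate zero    x = symK 1/0!≈1
  g-replicate (suc n) x = begin
    g w                        ≈⟨ partialProduct-stable w (bound-least w w<) ⟨
    partialProduct (suc x) w   ≡⟨ ∑-splits-∷ x (replicate n x) (λ (u , v) → partialProduct x u * exp x v) ⟩
    partialProduct x [] * exp x w + ∑ (splits (replicate n x)) (λ (u , v) → partialProduct x (x ∷ u) * exp x v)
      ≈⟨ +-cong (transK (*-congʳ (partialProduct-[] x)) (*-identityˡ _))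
                (∑-zero (splits (replicate n x)) λ _ →
                  transK (*-congʳ (partialProduct-∈ (ℕₚ.≤-refl {x}) (here refl))) (zeroˡ _)) ⟩
    exp x w + 0#               ≈⟨ +-identityʳ _ ⟩
    exp x w                    ≈⟨ if-yes (all? (_≟ x) w) (AllP.replicate⁺ (suc n) refl) ⟩
    1/ length w !              ≡⟨ cong 1/_! (length-replicate (suc n)) ⟩
    1/ suc n ! ∎
    where
    open SetoidReasoning setoid
    w = replicate (suc n) x
    w< : ∀ {y} → y ∈ w → y < suc x
    w< y∈ = s≤s (ℕₚ.≤-reflexive (All.lookup (AllP.replicate⁺ {P = _≡ x} (suc n) refl) y∈))

  h : Series
  h = g -ₛ 1ₛ

  h-[] : h [] ≈ 0#
  h-[] = -‿inverseʳ 1#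

  h-∷ : ∀ x w → h (x ∷ w) ≈ g (x ∷ w)
  h-∷ x w = transK (+-congˡ -0#≈0#) (+-identityʳ _)
    where open RingProperties ring using (-0#≈0#)

  h-++-∷ : ∀ p x w → h (p ++ x ∷ w) ≈ g (p ++ x ∷ w)
  h-++-∷ []      x w = h-∷ x w
  h-++-∷ (y ∷ p) x w = h-∷ y (p ++ x ∷ w)

  -- The list can stop at `length u`, since a cutting into nonempty factors has no more factors than
  -- letters; `coeff-H` extends the formula to every `k`.
  H : Word → K[t]
  H u = applyUpTo (λ k → (h ^ₛ k) u) (suc (length u))

  coeff-applyUpTo-< : ∀ f {m k} → k < m → coeff (applyUpTo f m) k ≡ f k
  coeff-applyUpTo-< f {suc m} {zero}  _         = refl
  coeff-applyUpTo-< f {suc m} {suc k} (s≤s k<m) = coeff-applyUpTo-< (f ∘ suc) k<m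

  coeff-applyUpTo-≥ : ∀ f {m k} → m ≤ k → coeff (applyUpTo f m) k ≡ 0#
  coeff-applyUpTo-≥ f {zero}          _         = refl
  coeff-applyUpTo-≥ f {suc m} {suc k} (s≤s m≤k) = coeff-applyUpTo-≥ (f ∘ suc) m≤k

  coeff-H : ∀ u k → coeff (H u) k ≈ (h ^ₛ k) u
  coeff-H u k with suc (length u) ≤? k
  ... | yes u<k = transK (reflexive (coeff-applyUpTo-≥ (λ k → (h ^ₛ k) u) u<k))
                         (symK (power-vanishes h h-[] k u u<k))
  ... | no  u≮k = reflexive (coeff-applyUpTo-< (λ k → (h ^ₛ k) u) (ℕₚ.≰⇒> u≮k))

  g^ᵗ≋ℱH : ∀ u → (g ^ᵗ) u ≋ ℱ 0 (H u)
  g^ᵗ≋ℱH u = mk≋ λ n → begin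
    coeff ((g ^ᵗ) u) n
      ≈⟨ coeff-∑ ks (λ k → (h ^ₛ k) u) (binomial 0) n ⟩
    ∑ ks (λ k → (h ^ₛ k) u * coeff (binomial 0 k) n)
      ≈⟨ ∑-cong ks (λ {k} _ → *-congʳ (coeff-H u k)) ⟨
    ∑ ks (λ k → coeff (H u) k * coeff (binomial 0 k) n)
      ≡⟨ cong (λ m → ∑ (upTo m) (λ k → coeff (H u) k * coeff (binomial 0 k) n)) (length-applyUpTo (λ k → (h ^ₛ k) u) (suc (length u))) ⟨
    ∑ (upTo (length (H u))) (λ k → coeff (H u) k * coeff (binomial 0 k) n)
      ≈⟨ coeff-∑ (upTo (length (H u))) (coeff (H u)) (binomial 0) n ⟨
    coeff (ℱ 0 (H u)) n ∎
    where
    open SetoidReasoning setoid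
    ks = upTo (suc (length u))

  -- Recursion on the first factor of a cutting, which either ends before `b` or contains it. The
  -- letter `b` also keeps the word nonempty, so the constant term is 0 and a factor t comes out.
  H-++-∷ : ∀ p b q → H (p ++ b ∷ q) ≋
    t *ₚ (∑ₚ (splits p) (λ (u , v) → h u • H (v ++ b ∷ q)) +ₚ ∑ₚ (splits q) (λ (u , v) → h (p ++ b ∷ u) • H v))
  H-++-∷ p b q = begin
    H (p ++ b ∷ q)
      ≈⟨ unfold p ⟩
    t *ₚ ∑ₚ (splits (p ++ b ∷ q)) F
      ≡⟨ cong (λ l → t *ₚ ∑ₚ l F) (splits-++-∷ p b q) ⟩
    t *ₚ ∑ₚ (map (Prod.map₂ (_++ b ∷ q)) (splits p) ++ map (Prod.map₁ (λ u → p ++ b ∷ u)) (splits q)) F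
      ≈⟨ P.*-congˡ {t} (∑ₚ-++ (map _ (splits p)) _ F) ⟩
    t *ₚ (∑ₚ (map (Prod.map₂ (_++ b ∷ q)) (splits p)) F +ₚ ∑ₚ (map (Prod.map₁ (λ u → p ++ b ∷ u)) (splits q)) F)
      ≡⟨ cong (t *ₚ_) (cong₂ _+ₚ_ (∑ₚ-map _ (splits p) F) (∑ₚ-map _ (splits q) F)) ⟩
    t *ₚ (∑ₚ (splits p) (λ (u , v) → h u • H (v ++ b ∷ q)) +ₚ ∑ₚ (splits q) (λ (u , v) → h (p ++ b ∷ u) • H v)) ∎
    where
    open SetoidReasoning P.setoid
    F : Word × Word → K[t]
    F (u , v) = h u • H v
    coefficients : ∀ w k → coeff (H w) (suc k) ≈ coeff (∑ₚ (splits w) F) k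
    coefficients w k = transK (coeff-H w (suc k))
      (symK (transK (coeff-∑ (splits w) (h ∘ proj₁) (H ∘ proj₂) k)
                    (∑-cong (splits w) λ {(u , v)} _ → *-congˡ (coeff-H v k))))
    unfold : ∀ p → H (p ++ b ∷ q) ≋ t *ₚ ∑ₚ (splits (p ++ b ∷ q)) F
    unfold p = P.trans (mk≋ λ { zero → constant p ; (suc k) → coefficients (p ++ b ∷ q) k }) (P.sym (t*-shift _))
      where
      constant : ∀ p → coeff (H (p ++ b ∷ q)) 0 ≈ 0#
      constant []      = reflK
      constant (_ ∷ _) = reflK

  H-∷ : ∀ c q → H (c ∷ q) ≋ t *ₚ ∑ₚ (splits q) (λ (u , v) → h (c ∷ u) • H v)
  H-∷ c q = P.trans (H-++-∷ [] c q)
    (P.*-congˡ {t} (P.+-congʳ {_} {_} {[]} (P.trans (P.+-identityʳ _) (0•-zero (H (c ∷ q)) h-[]))))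

  -- A cut between b and c is optional if ε = 1, forced if ε = 0.
  H-junction : ∀ ε {b c} → (∀ p q → h (p ++ b ∷ c ∷ q) ≈ ε * (h (p ++ [ b ]) * h (c ∷ q))) → ∀ p q →
    t *ₚ H (p ++ b ∷ c ∷ q) ≋ (t +ₚ const ε) *ₚ (H (p ++ [ b ]) *ₚ H (c ∷ q))
  H-junction ε {b} {c} h-junction p q = go (length p) p ℕₚ.≤-refl
    where
    open SetoidReasoning P.setoid
    -- Induction on a bound for the length of `p`: a first factor ending inside `p` leaves the same
    -- junction with a shorter prefix.
    go : ∀ n p → length p ≤ n →
      t *ₚ H (p ++ b ∷ c ∷ q) ≋ (t +ₚ const ε) *ₚ (H (p ++ [ b ]) *ₚ H (c ∷ q))
    go n p p≤n = begin
      t *ₚ H (p ++ b ∷ c ∷ q)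
        ≈⟨ P.*-congˡ {t} (H-++-∷ p b (c ∷ q)) ⟩
      t *ₚ (t *ₚ (A′ +ₚ ∑ₚ (splits (c ∷ q)) (λ (u , v) → h (p ++ b ∷ u) • H v)))
        -- The first factor ends before `b` (`A′`), ends at `b` (weight `x`, then `Hq`), or runs
        -- across the junction (the term with `ε` and `C`).
        ≈⟨ P.*-congˡ {t} (P.*-congˡ {t} (P.+-congˡ {A′} second)) ⟩
      t *ₚ (t *ₚ (A′ +ₚ (const x *ₚ Hq +ₚ const ε *ₚ (const x *ₚ C))))
        ≈⟨ PS.solve 6 (λ t A′ x Hq ε C → let open PS in
             t :* (t :* (A′ :+ (x :* Hq :+ ε :* (x :* C)))) :=
             t :* (t :* A′ :+ (t :* (x :* Hq) :+ ε :* (x :* (t :* C))))) P.refl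
             t A′ (const x) Hq (const ε) C ⟩
      t *ₚ (t *ₚ A′ +ₚ (t *ₚ (const x *ₚ Hq) +ₚ const ε *ₚ (const x *ₚ (t *ₚ C))))
        -- The inner t serves the induction hypothesis in `t *ₚ A′` and turns `C` into `Hq`; the
        -- outer one is kept to rebuild `H (p ++ [ b ])` through `prefix`.
        ≈⟨ P.*-congˡ {t} (P.+-cong first (P.+-congˡ {t *ₚ (const x *ₚ Hq)}
             (P.*-congˡ {const ε} (P.*-congˡ {const x} (P.sym (H-∷ c q)))))) ⟩
      t *ₚ ((t +ₚ const ε) *ₚ Hq *ₚ A +ₚ (t *ₚ (const x *ₚ Hq) +ₚ const ε *ₚ (const x *ₚ Hq)))
        ≈⟨ PS.solve 5 (λ t A x Hq ε → let open PS in
             t :* ((t :+ ε) :* Hq :* A :+ (t :* (x :* Hq) :+ ε :* (x :* Hq))) :=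
             (t :+ ε) :* ((t :* (A :+ x)) :* Hq)) P.refl
             t A (const x) Hq (const ε) ⟩
      (t +ₚ const ε) *ₚ ((t *ₚ (A +ₚ const x)) *ₚ Hq)
        ≈⟨ P.*-congˡ {t +ₚ const ε} (P.*-congʳ {Hq} prefix) ⟨
      (t +ₚ const ε) *ₚ (H (p ++ [ b ]) *ₚ Hq) ∎
      where
      x  = h (p ++ [ b ])
      Hq = H (c ∷ q)
      A′ = ∑ₚ (splits p) (λ (u , v) → h u • H (v ++ b ∷ c ∷ q))
      A  = ∑ₚ (splits p) (λ (u , v) → h u • H (v ++ [ b ]))
      C  = ∑ₚ (splits q) (λ (u , v) → h (c ∷ u) • H v)
      prefix : H (p ++ [ b ]) ≋ t *ₚ (A +ₚ const x)
      prefix = P.trans (H-++-∷ p b [])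
        (P.*-congˡ {t} (P.+-congˡ {A} (P.trans (P.+-identityʳ _) (P.trans (•-const x 1ₚ) (P.*-identityʳ (const x))))))
      second : ∑ₚ (splits (c ∷ q)) (λ (u , v) → h (p ++ b ∷ u) • H v) ≋ const x *ₚ Hq +ₚ const ε *ₚ (const x *ₚ C)
      second = P.+-cong (•-const x Hq) (begin
        ∑ₚ (map (Prod.map₁ (c ∷_)) (splits q)) (λ (u , v) → h (p ++ b ∷ u) • H v)
          ≡⟨ ∑ₚ-map _ (splits q) _ ⟩
        ∑ₚ (splits q) (λ (u , v) → h (p ++ b ∷ c ∷ u) • H v)
          ≈⟨ ∑ₚ-cong (splits q) (λ {(u , v)} _ → P.trans (•-congʳ (H v) (h-junction p u))
               (P.trans (•-assoc ε _ (H v)) (•-congˡ ε (•-assoc x (h (c ∷ u)) (H v))))) ⟩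
        ∑ₚ (splits q) (λ (u , v) → ε • (x • (h (c ∷ u) • H v)))
          ≈⟨ ∑ₚ-•ˡ (splits q) ε (λ (u , v) → x • (h (c ∷ u) • H v)) ⟩
        const ε *ₚ ∑ₚ (splits q) (λ (u , v) → x • (h (c ∷ u) • H v))
          ≈⟨ P.*-congˡ {const ε} (∑ₚ-•ˡ (splits q) x (λ (u , v) → h (c ∷ u) • H v)) ⟩
        const ε *ₚ (const x *ₚ C) ∎)
      term : ∀ n p → length p ≤ n → ∀ {uv} → uv ∈ splits p →
        t *ₚ (h (proj₁ uv) • H (proj₂ uv ++ b ∷ c ∷ q)) ≋
        (t +ₚ const ε) *ₚ Hq *ₚ (h (proj₁ uv) • H (proj₂ uv ++ [ b ]))
      -- An empty first factor would not shorten the prefix, but its weight `h []` is 0.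
      term n p p≤n {[] , v} uv∈ = P.trans
        (P.trans (P.*-congˡ {t} (0•-zero (H (v ++ b ∷ c ∷ q)) h-[])) (P.zeroʳ t))
        (P.sym (P.trans (P.*-congˡ {(t +ₚ const ε) *ₚ Hq} (0•-zero (H (v ++ [ b ])) h-[])) (P.zeroʳ ((t +ₚ const ε) *ₚ Hq))))
      term zero    p p≤n {y ∷ u , v} uv∈ = ⊥-elim (ℕₚ.n≮0 (ℕₚ.≤-trans
        (ℕₚ.≤-reflexive (trans (sym (length-++ (y ∷ u))) (cong length (splits-++ p uv∈)))) p≤n))
      term (suc n) p p≤n {y ∷ u , v} uv∈ = begin
        t *ₚ (k • H (v ++ b ∷ c ∷ q))
          ≈⟨ P.*-congˡ {t} (•-const k (H (v ++ b ∷ c ∷ q))) ⟩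
        t *ₚ (const k *ₚ H (v ++ b ∷ c ∷ q))
          ≈⟨ PS.solve 3 (λ t k z → let open PS in t :* (k :* z) := k :* (t :* z)) P.refl t (const k) (H (v ++ b ∷ c ∷ q)) ⟩
        const k *ₚ (t *ₚ H (v ++ b ∷ c ∷ q))
          ≈⟨ P.*-congˡ {const k} (go n v v≤n) ⟩
        const k *ₚ ((t +ₚ const ε) *ₚ (H (v ++ [ b ]) *ₚ Hq))
          ≈⟨ PS.solve 4 (λ k z w y → let open PS in k :* (z :* (w :* y)) := z :* y :* (k :* w)) P.refl (const k) (t +ₚ const ε) (H (v ++ [ b ])) Hq ⟩
        (t +ₚ const ε) *ₚ Hq *ₚ (const k *ₚ H (v ++ [ b ]))
          ≈⟨ P.*-congˡ {(t +ₚ const ε) *ₚ Hq} (•-const k (H (v ++ [ b ]))) ⟨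
        (t +ₚ const ε) *ₚ Hq *ₚ (k • H (v ++ [ b ])) ∎
        where
        k = h (y ∷ u)
        v≤n : length v ≤ n
        v≤n = ℕₚ.≤-trans (ℕₚ.m≤n+m (length v) (length u)) (ℕₚ.≤-pred (ℕₚ.≤-trans
          (ℕₚ.≤-reflexive (trans (sym (length-++ (y ∷ u))) (cong length (splits-++ p uv∈)))) p≤n))
      first : t *ₚ A′ ≋ (t +ₚ const ε) *ₚ Hq *ₚ A
      first = P.trans (P.sym (∑ₚ-*ˡ (splits p) t _))
        (P.trans (∑ₚ-cong (splits p) (term n p p≤n)) (∑ₚ-*ˡ (splits p) ((t +ₚ const ε) *ₚ Hq) _))

-- Descents of words, and factors of words that begin with a block.

ascents : Word → ℕ
ascents []          = 0
ascents (x ∷ [])    = 0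
ascents (x ∷ y ∷ w) = (if does (y <? x) then 0 else 1) ℕ.+ ascents (y ∷ w)

descents+ascents : ∀ x w → descents (x ∷ w) ℕ.+ ascents (x ∷ w) ≡ length w
descents+ascents x []      = refl
descents+ascents x (y ∷ w) with does (y <? x)
... | true  = cong suc (descents+ascents y w)
... | false = trans (ℕₚ.+-suc _ _) (cong suc (descents+ascents y w))

descents-< : ∀ {x y} w → y < x → descents (x ∷ y ∷ w) ≡ suc (descents (y ∷ w))
descents-< {x} {y} w y<x rewrite dec-true (y <? x) y<x = refl

descents-≮ : ∀ {x y} w → ¬ y < x → descents (x ∷ y ∷ w) ≡ descents (y ∷ w)
descents-≮ {x} {y} w y≮x rewrite dec-false (y <? x) y≮x = refl

replicate-++-∷ : ∀ j (x : ℕ) v → x ∷ replicate j x ++ v ≡ replicate j x ++ x ∷ v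
replicate-++-∷ zero    x v = refl
replicate-++-∷ (suc j) x v = cong (x ∷_) (replicate-++-∷ j x v)

module _ {ℓ} {R : Rel ℕ ℓ} (R? : Decidable R) where

  factors-yes : ∀ {x y} w → R x y → factors R? (x ∷ y ∷ w) ≡ attach x (factors R? (y ∷ w))
  factors-yes {x} {y} w r rewrite dec-true (R? x y) r = refl

  factors-no : ∀ {x y} w → ¬ R x y → factors R? (x ∷ y ∷ w) ≡ [ x ] ∷ factors R? (y ∷ w)
  factors-no {x} {y} w ¬r rewrite dec-false (R? x y) ¬r = refl

  length-factors-yes : ∀ {x y} w → R x y → length (factors R? (x ∷ y ∷ w)) ≡ length (factors R? (y ∷ w))
  length-factors-yes {x} {y} w r = trans (cong length (factors-yes w r)) (trans (length-attach x (factors R? (y ∷ w))) (nonempty y w))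
    where
    nonempty : ∀ y w → suc (pred (length (factors R? (y ∷ w)))) ≡ length (factors R? (y ∷ w))
    nonempty y []      = refl
    nonempty y (z ∷ w) with does (R? y z)
    ... | true  = trans (cong (suc ∘ pred) (length-attach y fs)) (sym (length-attach y fs))
      where fs = factors R? (z ∷ w)
    ... | false = refl

  length-factors-replicate : (∀ {x} → R x x) → ∀ j x w →
    length (factors R? (x ∷ replicate j x ++ w)) ≡ length (factors R? (x ∷ w))
  length-factors-replicate R-refl zero    x w = refl
  length-factors-replicate R-refl (suc j) x w =
    trans (length-factors-yes (replicate j x ++ w) R-refl) (length-factors-replicate R-refl j x w)

factors-≟-replicate : ∀ j x → factors _≟_ (replicate (suc j) x) ≡ [ replicate (suc j) x ]
factors-≟-replicate zero    x = refl
factors-≟-replicate (suc j) x =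
  trans (factors-yes _≟_ (replicate j x) refl) (cong (attach x) (factors-≟-replicate j x))

factors-≟-++ : ∀ j {x y} w → x ≢ y →
  factors _≟_ (replicate (suc j) x ++ y ∷ w) ≡ replicate (suc j) x ∷ factors _≟_ (y ∷ w)
factors-≟-++ zero        w x≢y = factors-no _≟_ w x≢y
factors-≟-++ (suc j) {x} {y} w x≢y =
  trans (factors-yes _≟_ (replicate j x ++ y ∷ w) refl) (cong (attach x) (factors-≟-++ j w x≢y))

-- Single blocks: powers of e^z - 1 and Eulerian polynomials.

module Blocks {a ℓ} (K : Field a ℓ) (char0 : CharacteristicZero K) where

  open Field K hiding (zero)
  open Over K char0
  open Polynomials K char0
  open BinomialBasis K char0
  open Junctions K char0

  module _ (x : ℕ) where

    -- The value at n is read as the coefficient of z^n. On powers of one letter `*ₛ` becomes the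
    -- product of power series, and `h` becomes e^z - 1.
    onPowers : Series → ℕ → Carrier
    onPowers f n = f (replicate n x)

    onPowers-* : ∀ f f′ n → onPowers (f *ₛ f′) n ≈ (onPowers f ⋆ onPowers f′) n
    onPowers-* f f′ zero    = +-identityʳ _
    onPowers-* f f′ (suc n) =
      transK (reflexive (∑-splits-∷ x (replicate n x) (λ (u , v) → f u * f′ v)))
             (+-congˡ (onPowers-* (f ∘ (x ∷_)) f′ n))

    -- d(e^z − 1)/dz = (e^z − 1) + 1
    ∂-h : ∀ n → ∂ (onPowers h) n ≈ onPowers h n + onPowers 1ₛ n
    ∂-h n = begin
      suc n · h (replicate (suc n) x)
        ≈⟨ ·-congʳ (suc n) (transK (h-∷ x (replicate n x)) (g-replicate (suc n) x)) ⟩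
      suc n · (1/ suc n !)        ≈⟨ ·-congʳ (suc n) (*-identityʳ _) ⟨
      suc n · (1/ suc n ! * 1#)   ≈⟨ ·-comm-* (suc n) _ 1# ⟨
      1/ suc n ! * (suc n · 1#)   ≈⟨ 1/suc! n ⟩
      1/ n !                      ≈⟨ g-replicate n x ⟨
      g (replicate n x)           ≈⟨ transK (+-congˡ (-‿inverseˡ _)) (+-identityʳ _) ⟨
      g (replicate n x) + (- onPowers 1ₛ n + onPowers 1ₛ n) ≈⟨ +-assoc _ _ _ ⟨
      h (replicate n x) + onPowers 1ₛ n ∎
      where open SetoidReasoning setoid

    -- The chain rule gives (k+1) (e^z - 1)^k e^z; writing e^z as (e^z - 1) + 1 leaves only powers
    -- of e^z - 1.
    ∂-h^ : ∀ k n → ∂ (onPowers (h ^ₛ suc k)) n ≈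
      (suc k · 1#) * (onPowers (h ^ₛ suc k) n + onPowers (h ^ₛ k) n)
    ∂-h^ k n = begin
      ∂ (onPowers (h ^ₛ suc k)) n
        ≈⟨ ·-congʳ (suc n) (onPowers-* h (h ^ₛ k) (suc n)) ⟩
      ∂ (ĥ ⋆ onPowers (h ^ₛ k)) n
        ≈⟨ ∂-⋆ ĥ _ n ⟩
      (∂ ĥ ⋆ onPowers (h ^ₛ k)) n + (ĥ ⋆ ∂ (onPowers (h ^ₛ k))) n
        ≈⟨ +-cong (transK (⋆-cong ∂-h (λ _ → reflK) n) (⋆-distribʳ (onPowers (h ^ₛ k)) ĥ (onPowers 1ₛ) n)) (rest k) ⟩
      ((ĥ ⋆ onPowers (h ^ₛ k)) n + (onPowers 1ₛ ⋆ onPowers (h ^ₛ k)) n) + (k · 1#) * s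
        ≈⟨ +-congʳ (+-cong (symK (onPowers-* h (h ^ₛ k) n)) (⋆-identityˡ _ reflK (λ _ → reflK) n)) ⟩
      s + (k · 1#) * s
        ≈⟨ KS.solve 2 (λ c s → let open KS in s :+ c :* s := (con 1 :+ c) :* s) reflK (k · 1#) s ⟩
      (suc k · 1#) * s ∎
      where
      open SetoidReasoning setoid
      ĥ = onPowers h
      s = onPowers (h ^ₛ suc k) n + onPowers (h ^ₛ k) n
      rest : ∀ k → (ĥ ⋆ ∂ (onPowers (h ^ₛ k))) n ≈ (k · 1#) * (onPowers (h ^ₛ suc k) n + onPowers (h ^ₛ k) n)
      rest zero    = begin
        (ĥ ⋆ ∂ (onPowers 1ₛ)) n      ≈⟨ ⋆-cong {f = ĥ} (λ _ → reflK) (λ m → ·-zeroʳ (suc m)) n ⟩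
        (ĥ ⋆ (λ _ → 0#)) n           ≈⟨ ⋆-comm ĥ _ n ⟩
        ((λ _ → 0#) ⋆ ĥ) n           ≈⟨ ⋆-zeroˡ ĥ n ⟩
        0#                           ≈⟨ zeroˡ _ ⟨
        0# * (onPowers (h ^ₛ 1) n + onPowers 1ₛ n) ∎
      rest (suc k) = begin
        (ĥ ⋆ ∂ (onPowers (h ^ₛ suc k))) n
          ≈⟨ ⋆-cong {f = ĥ} (λ _ → reflK) (∂-h^ k) n ⟩
        (ĥ ⋆ (λ m → (suc k · 1#) * (η₁ m + η₀ m))) n
          ≈⟨ ⋆-comm ĥ _ n ⟩
        ((λ m → (suc k · 1#) * (η₁ m + η₀ m)) ⋆ ĥ) n
          ≈⟨ ⋆-scale (suc k · 1#) (λ m → η₁ m + η₀ m) ĥ n ⟩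
        (suc k · 1#) * ((λ m → η₁ m + η₀ m) ⋆ ĥ) n
          ≈⟨ *-congˡ (⋆-distribʳ ĥ η₁ η₀ n) ⟩
        (suc k · 1#) * ((η₁ ⋆ ĥ) n + (η₀ ⋆ ĥ) n)
          ≈⟨ *-congˡ (+-cong (⋆-comm η₁ ĥ n) (⋆-comm η₀ ĥ n)) ⟩
        (suc k · 1#) * ((ĥ ⋆ η₁) n + (ĥ ⋆ η₀) n)
          ≈⟨ *-congˡ (+-cong (onPowers-* h (h ^ₛ suc k) n) (onPowers-* h (h ^ₛ k) n)) ⟨
        (suc k · 1#) * (onPowers (h ^ₛ suc (suc k)) n + onPowers (h ^ₛ suc k) n) ∎
        where
        η₁ = onPowers (h ^ₛ suc k)
        η₀ = onPowers (h ^ₛ k)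

    -- This is `∂-h^` for fixed n, read as an identity of polynomials in t: adding the coefficients
    -- at k and k + 1 is multiplication by t + 1, and the multiplier k + 1 is d/dt.
    H-replicate-suc : ∀ n → suc n ·ₚ H (replicate (suc n) x) ≋ t *ₚ D ((t +ₚ 1ₚ) *ₚ H (replicate n x))
    H-replicate-suc n = P.trans (mk≋ coefficients) (P.sym (t*-shift (D ((t +ₚ 1ₚ) *ₚ W))))
      where
      open SetoidReasoning setoid
      W = H (replicate n x)
      W′ = H (replicate (suc n) x)
      coefficients : ∀ k → coeff (suc n ·ₚ W′) k ≈ coeff (0# ∷ D ((t +ₚ 1ₚ) *ₚ W)) k
      coefficients zero    = transK (coeff-·ₚ (suc n) W′ 0) (transK (·-as-* (suc n) _)
        (transK (*-congˡ (coeff-H (replicate (suc n) x) 0)) (zeroʳ _)))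
      coefficients (suc k) = begin
        coeff (suc n ·ₚ W′) (suc k)
          ≈⟨ coeff-·ₚ (suc n) W′ (suc k) ⟩
        suc n · coeff W′ (suc k)
          ≈⟨ ·-congʳ (suc n) (coeff-H (replicate (suc n) x) (suc k)) ⟩
        ∂ (onPowers (h ^ₛ suc k)) n
          ≈⟨ ∂-h^ k n ⟩
        (suc k · 1#) * (onPowers (h ^ₛ suc k) n + onPowers (h ^ₛ k) n)
          ≈⟨ ·-as-* (suc k) _ ⟨
        suc k · (onPowers (h ^ₛ suc k) n + onPowers (h ^ₛ k) n)
          ≈⟨ ·-congʳ (suc k) (transK (+-comm _ _)
               (+-cong (symK (coeff-H (replicate n x) k)) (symK (coeff-H (replicate n x) (suc k))))) ⟩
        suc k · (coeff W k + coeff W (suc k))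
          ≈⟨ ·-congʳ (suc k) (+-congʳ (coeffs (t*-shift W) (suc k))) ⟨
        suc k · (coeff (t *ₚ W) (suc k) + coeff W (suc k))
          ≈⟨ ·-congʳ (suc k) (coeff-+ (t *ₚ W) W (suc k)) ⟨
        suc k · coeff (t *ₚ W +ₚ W) (suc k)
          ≈⟨ ·-congʳ (suc k) (coeffs (PS.solve 2 (λ t w → let open PS in t :* w :+ w := (t :+ con 1) :* w) P.refl t W) (suc k)) ⟩
        suc k · coeff ((t +ₚ 1ₚ) *ₚ W) (suc k)
          ≈⟨ coeff-D ((t +ₚ 1ₚ) *ₚ W) k ⟨
        coeff (D ((t +ₚ 1ₚ) *ₚ W)) k ∎

  -- A largest letter put inside a descent or at the end keeps the number of descents; put inside an
  -- ascent or at the front it raises that number by one.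
  ∑ₚ-insertions : ∀ {m y} ys (F : ℕ → K[t]) → All (_< m) (y ∷ ys) →
    ∑ₚ (insertions m (y ∷ ys)) (F ∘ descents) ≋
    suc (descents (y ∷ ys)) ·ₚ F (descents (y ∷ ys)) +ₚ suc (ascents (y ∷ ys)) ·ₚ F (suc (descents (y ∷ ys)))
  ∑ₚ-insertions {m} {y} ys F (y<m ∷ ys<m) = begin
    F (descents (m ∷ y ∷ ys)) +ₚ ∑ₚ (map (y ∷_) (insertions m ys)) (F ∘ descents)
      ≡⟨ cong₂ _+ₚ_ (cong F (descents-< ys y<m)) (∑ₚ-map (y ∷_) (insertions m ys) (F ∘ descents)) ⟩
    F (suc d) +ₚ ∑ₚ (insertions m ys) (F ∘ descents ∘ (y ∷_))
      ≈⟨ P.+-congˡ {F (suc d)} (after-first y ys F (y<m ∷ ys<m)) ⟩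
    F (suc d) +ₚ (suc d ·ₚ F d +ₚ ascents (y ∷ ys) ·ₚ F (suc d))
      ≈⟨ PS.solve 3 (λ x y z → let open PS in x :+ (y :+ z) := y :+ (x :+ z)) P.refl (F (suc d)) (suc d ·ₚ F d) _ ⟩
    suc d ·ₚ F d +ₚ suc (ascents (y ∷ ys)) ·ₚ F (suc d) ∎
    where
    open SetoidReasoning P.setoid
    d = descents (y ∷ ys)
    -- `F` varies in the induction: a letter in front adds 0 or 1 to every descent number, and this
    -- shift is absorbed into `F`.
    after-first : ∀ y ys (F : ℕ → K[t]) → All (_< m) (y ∷ ys) →
      ∑ₚ (insertions m ys) (F ∘ descents ∘ (y ∷_)) ≋
      suc (descents (y ∷ ys)) ·ₚ F (descents (y ∷ ys)) +ₚ ascents (y ∷ ys) ·ₚ F (suc (descents (y ∷ ys)))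
    after-first y [] F (y<m ∷ []) = P.trans
      (P.reflexive (cong (λ d → F d +ₚ []) (descents-≮ [] (ℕₚ.<⇒≯ y<m))))
      (P.sym (P.+-identityʳ (F 0 +ₚ [])))
    after-first y (z ∷ zs) F (y<m ∷ z<m ∷ zs<m) = P.trans
      (P.+-cong (P.reflexive (cong F (trans (descents-≮ (z ∷ zs) (ℕₚ.<⇒≯ y<m)) (descents-< zs z<m))))
        (P.trans (P.reflexive (∑ₚ-map (z ∷_) (insertions m zs) (F ∘ descents ∘ (y ∷_))))
                 (after-first z zs (λ d → F ((if does (z <? y) then 1 else 0) ℕ.+ d)) (z<m ∷ zs<m))))
      (step (does (z <? y)))
      where
      d′ = descents (z ∷ zs)
      a′ = ascents (z ∷ zs)
      -- The term `F (suc d′)` comes from `m` placed between `y` and `z`: it joins the unchanged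
      -- numbers if `y`, `z` was a descent, and the raised ones otherwise.
      step : ∀ b → let e = if b then 1 else 0 in
        F (suc d′) +ₚ (suc d′ ·ₚ F (e ℕ.+ d′) +ₚ a′ ·ₚ F (e ℕ.+ suc d′)) ≋
        suc (e ℕ.+ d′) ·ₚ F (e ℕ.+ d′) +ₚ ((if b then 0 else 1) ℕ.+ a′) ·ₚ F (suc (e ℕ.+ d′))
      step true  = P.sym (P.+-assoc (F (suc d′)) (suc d′ ·ₚ F (suc d′)) _)
      step false = PS.solve 3 (λ x y z → let open PS in x :+ (y :+ z) := y :+ (x :+ z)) P.refl (F (suc d′)) (suc d′ ·ₚ F d′) _

  D-t : D t ≋ 1ₚ
  D-t = mk≋ λ { 0 → +-identityʳ 1# ; 1 → reflK ; (suc (suc n)) → reflK }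

  D-t+1 : D (t +ₚ 1ₚ) ≋ 1ₚ
  D-t+1 = mk≋ λ { 0 → +-identityʳ 1# ; 1 → reflK ; (suc (suc n)) → reflK }

  D-^ : ∀ {p} → D p ≋ 1ₚ → ∀ k → D (p ^ₚ suc k) ≋ suc k ·ₚ p ^ₚ k
  D-^ {p} Dp≋1 zero    = P.trans (D-cong (P.*-identityʳ p)) Dp≋1
  D-^ {p} Dp≋1 (suc k) = begin
    D (p *ₚ p ^ₚ suc k)
      ≈⟨ D-* p (p ^ₚ suc k) ⟩
    D p *ₚ p ^ₚ suc k +ₚ p *ₚ D (p ^ₚ suc k)
      ≈⟨ P.+-cong (P.trans (P.*-congʳ {p ^ₚ suc k} Dp≋1) (P.*-identityˡ (p ^ₚ suc k)))
                  (P.trans (P.*-congˡ {p} (D-^ Dp≋1 k)) (·ₚ-comm-* (suc k) p (p ^ₚ k))) ⟩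
    suc (suc k) ·ₚ p ^ₚ suc k ∎
    where open SetoidReasoning P.setoid

  eulerian : ℕ → K[t]
  eulerian n = Eulerian n t (t +ₚ 1ₚ)

  -- With y = t + 1, the insertions into a permutation with d descents and e ascents give (d+1) t^d
  -- y^{e+1} + (e+1) t^{d+1} y^e. As t and y both have derivative 1, this is the derivative of
  -- t^{d+1} y^{e+1}.
  eulerian-suc : ∀ n → eulerian (suc (suc n)) ≋ D (t *ₚ ((t +ₚ 1ₚ) *ₚ eulerian (suc n)))
  eulerian-suc n = begin
    eulerian (suc (suc n))
      ≈⟨ ∑ₚ-concatMap (insertions (suc n)) (permutations (suc n)) _ ⟩
    ∑ₚ (permutations (suc n)) (λ τ → ∑ₚ (insertions (suc n) τ) (F ∘ descents))
      ≈⟨ ∑ₚ-cong (permutations (suc n)) (λ τ∈ → insert (permutations-sound (suc n) τ∈)) ⟩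
    ∑ₚ (permutations (suc n)) (λ τ → D (t *ₚ (y *ₚ (t ^ₚ descents τ *ₚ y ^ₚ (n ∸ descents τ)))))
      ≈⟨ D-∑ (permutations (suc n)) _ ⟨
    D (∑ₚ (permutations (suc n)) (λ τ → t *ₚ (y *ₚ (t ^ₚ descents τ *ₚ y ^ₚ (n ∸ descents τ)))))
      ≈⟨ D-cong (P.trans (∑ₚ-*ˡ (permutations (suc n)) t _) (P.*-congˡ {t} (∑ₚ-*ˡ (permutations (suc n)) y _))) ⟩
    D (t *ₚ (y *ₚ eulerian (suc n))) ∎
    where
    open SetoidReasoning P.setoid
    y = t +ₚ 1ₚ
    F : ℕ → K[t]
    F d = t ^ₚ d *ₚ y ^ₚ (suc n ∸ d)
    insert : ∀ {τ} → τ ↭ upTo (suc n) →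
      ∑ₚ (insertions (suc n) τ) (F ∘ descents) ≋ D (t *ₚ (y *ₚ (t ^ₚ descents τ *ₚ y ^ₚ (n ∸ descents τ))))
    insert {[]}     τ↭ with () ← trans (↭-length τ↭) (length-upTo (suc n))
    insert {z ∷ zs} τ↭ = begin
      ∑ₚ (insertions (suc n) (z ∷ zs)) (F ∘ descents)
        ≈⟨ ∑ₚ-insertions zs F (All.tabulate (λ w∈ → ∈-upTo⁻ (∈-resp-↭ τ↭ w∈))) ⟩
      suc d ·ₚ F d +ₚ suc e ·ₚ F (suc d)
        ≡⟨ cong₂ (λ k l → suc d ·ₚ (t ^ₚ d *ₚ y ^ₚ k) +ₚ suc e ·ₚ (t ^ₚ suc d *ₚ y ^ₚ l)) 1+n∸d n∸d ⟩
      suc d ·ₚ (t ^ₚ d *ₚ y ^ₚ suc e) +ₚ suc e ·ₚ (t ^ₚ suc d *ₚ y ^ₚ e)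
        ≈⟨ P.+-cong (P.trans (P.*-congʳ {y ^ₚ suc e} (D-^ D-t d)) (·ₚ-assoc-* (suc d) (t ^ₚ d) (y ^ₚ suc e)))
                    (P.trans (P.*-congˡ {t ^ₚ suc d} (D-^ D-t+1 e)) (·ₚ-comm-* (suc e) (t ^ₚ suc d) (y ^ₚ e))) ⟨
      D (t ^ₚ suc d) *ₚ y ^ₚ suc e +ₚ t ^ₚ suc d *ₚ D (y ^ₚ suc e)
        ≈⟨ D-* (t ^ₚ suc d) (y ^ₚ suc e) ⟨
      D (t ^ₚ suc d *ₚ y ^ₚ suc e)
        ≈⟨ D-cong (PS.solve 4 (λ t y u v → let open PS in (t :* u) :* (y :* v) := t :* (y :* (u :* v))) P.refl t y (t ^ₚ d) (y ^ₚ e)) ⟩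
      D (t *ₚ (y *ₚ (t ^ₚ d *ₚ y ^ₚ e)))
        ≡⟨ cong (λ k → D (t *ₚ (y *ₚ (t ^ₚ d *ₚ y ^ₚ k)))) n∸d ⟨
      D (t *ₚ (y *ₚ (t ^ₚ d *ₚ y ^ₚ (n ∸ d)))) ∎
      where
      d = descents (z ∷ zs)
      e = ascents (z ∷ zs)
      n≡d+e : n ≡ d ℕ.+ e
      n≡d+e = trans (sym (ℕₚ.suc-injective (trans (↭-length τ↭) (length-upTo (suc n))))) (sym (descents+ascents z zs))
      n∸d : n ∸ d ≡ e
      n∸d = trans (cong (_∸ d) n≡d+e) (ℕₚ.m+n∸m≡n d e)
      1+n∸d : suc n ∸ d ≡ suc e
      1+n∸d = trans (cong (_∸ d) (trans (cong suc n≡d+e) (sym (ℕₚ.+-suc d e)))) (ℕₚ.m+n∸m≡n d (suc e))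

  -- The factor t aligns the two recurrences: t (t+1) E under the derivative is (t+1) times t E. The
  -- induction starts from `H []`, which is 1.
  t*eulerian : ∀ n x → t *ₚ eulerian (suc n) ≋ (suc n !) ·ₚ H (replicate (suc n) x)
  t*eulerian zero x = P.sym (P.trans (H-replicate-suc x 0)
    (P.*-congˡ {t} (P.trans (D-cong (P.*-identityʳ (t +ₚ 1ₚ))) (P.trans D-t+1
      (P.sym (P.trans (P.+-identityʳ (1ₚ *ₚ 1ₚ)) (P.*-identityˡ 1ₚ)))))))
  t*eulerian (suc n) x = begin
    t *ₚ eulerian (suc (suc n))
      ≈⟨ P.*-congˡ {t} (eulerian-suc n) ⟩
    t *ₚ D (t *ₚ (y *ₚ eulerian (suc n)))
      ≈⟨ P.*-congˡ {t} (D-cong (PS.solve 3 (λ t y a → let open PS in t :* (y :* a) := y :* (t :* a)) P.refl t y (eulerian (suc n)))) ⟩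
    t *ₚ D (y *ₚ (t *ₚ eulerian (suc n)))
      ≈⟨ P.*-congˡ {t} (D-cong (P.trans (P.*-congˡ {y} (t*eulerian n x)) (·ₚ-comm-* m y W))) ⟩
    t *ₚ D (m ·ₚ (y *ₚ W))
      ≈⟨ P.*-congˡ {t} (D-·ₚ m (y *ₚ W)) ⟩
    t *ₚ (m ·ₚ D (y *ₚ W))
      ≈⟨ ·ₚ-comm-* m t (D (y *ₚ W)) ⟩
    m ·ₚ (t *ₚ D (y *ₚ W))
      ≈⟨ ·ₚ-congʳ m (H-replicate-suc x (suc n)) ⟨
    m ·ₚ (suc (suc n) ·ₚ H (replicate (suc (suc n)) x))
      ≈⟨ ·ₚ-assocˡ (H (replicate (suc (suc n)) x)) m (suc (suc n)) ⟩
    (m ℕ.* suc (suc n)) ·ₚ H (replicate (suc (suc n)) x)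
      ≡⟨ cong (_·ₚ H (replicate (suc (suc n)) x)) (ℕₚ.*-comm m (suc (suc n))) ⟩
    (suc (suc n) !) ·ₚ H (replicate (suc (suc n)) x) ∎
    where
    open SetoidReasoning P.setoid
    y = t +ₚ 1ₚ
    m = suc n !
    W = H (replicate (suc n) x)

  H-replicate : ∀ n x → 1/ suc n ! • (t *ₚ eulerian (suc n)) ≋ H (replicate (suc n) x)
  H-replicate n x = P.trans (•-congˡ (1/ suc n !) (t*eulerian n x)) (n!•-inverse (suc n) _)

  -- Assembly of a word from its blocks.

  -- The last two fields say H u = ((t+1)/t)^a (E J), a = ℓ(J) − ℓ(I), without
  -- division.
  record Factorization (u : Word) : Set (a ⊔ ℓ) where
    field
      ascentCount : ℕ
      cofactor    : K[t]
      lengths     : length (blockComposition u) ≡ length (runComposition u) ℕ.+ ascentCount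
      E-blocks    : E (blockComposition u) ≋ t ^ₚ ascentCount *ₚ cofactor
      H-word      : H u ≋ (t +ₚ 1ₚ) ^ₚ ascentCount *ₚ cofactor

  -- What the ascent and the descent case share: one more block in front of a word already treated,
  -- hence one new junction.
  module Boundary (j : ℕ) {x y : ℕ} (w : Word) (x≢y : x ≢ y) (rest : Factorization (y ∷ w)) where

    open Factorization rest public renaming (ascentCount to k; cofactor to Q)
    open SetoidReasoning P.setoid public

    u : Word
    u = x ∷ replicate j x ++ y ∷ w
    J₀ = blockComposition (y ∷ w)
    B  = H (replicate (suc j) x)

    blocks-u : blockComposition u ≡ suc j ∷ J₀
    blocks-u = trans (cong (map length) (factors-≟-++ j w x≢y)) (cong (_∷ J₀) (length-replicate (suc j)))

    E-u : E (blockComposition u) ≋ B *ₚ (t ^ₚ k *ₚ Q)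
    E-u = P.trans (P.reflexive (cong E blocks-u)) (P.*-cong (H-replicate j x) E-blocks)

    runs-u : length (runComposition u) ≡ length (factors _≤?_ (x ∷ y ∷ w))
    runs-u = trans (length-map length (factors _≤?_ u)) (length-factors-replicate _≤?_ ℕₚ.≤-refl j x (y ∷ w))

    runs-tail : length (factors _≤?_ (y ∷ w)) ≡ length (runComposition (y ∷ w))
    runs-tail = sym (length-map length (factors _≤?_ (y ∷ w)))

    t*H-u : ∀ ε → (∀ p q → g (p ++ x ∷ y ∷ q) ≈ ε * (g (p ++ [ x ]) * g (y ∷ q))) →
      t *ₚ H u ≋ (t +ₚ const ε) *ₚ (B *ₚ ((t +ₚ 1ₚ) ^ₚ k *ₚ Q))
    t*H-u ε g-junction = begin
      t *ₚ H u
        -- The last `x` of the block is split off, since it is the letter next to the junction.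
        ≡⟨ cong (λ v → t *ₚ H v) (replicate-++-∷ j x (y ∷ w)) ⟩
      t *ₚ H (replicate j x ++ x ∷ y ∷ w)
        ≈⟨ H-junction ε (λ p q → transK (h-++-∷ p x (y ∷ q)) (transK (g-junction p q)
             (*-congˡ (*-cong (symK (h-++-∷ p x [])) (symK (h-∷ y q)))))) (replicate j x) w ⟩
      (t +ₚ const ε) *ₚ (H (replicate j x ++ [ x ]) *ₚ H (y ∷ w))
        ≡⟨ cong (λ v → (t +ₚ const ε) *ₚ (H v *ₚ H (y ∷ w)))
             (trans (sym (replicate-++-∷ j x [])) (cong (x ∷_) (++-identityʳ (replicate j x)))) ⟩
      (t +ₚ const ε) *ₚ (B *ₚ H (y ∷ w))
        ≈⟨ P.*-congˡ {t +ₚ const ε} (P.*-congˡ {B} H-word) ⟩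
      (t +ₚ const ε) *ₚ (B *ₚ ((t +ₚ 1ₚ) ^ₚ k *ₚ Q)) ∎

  -- The new block adds to s but not to r. The factor t of `B` is split off: in `E` it is the
  -- additional power of t; in `H` it cancels the t of the junction rule and leaves the additional t
  -- + 1.
  factorization-< : ∀ j {x y} w → x < y → Factorization (y ∷ w) → Factorization (x ∷ replicate j x ++ y ∷ w)
  factorization-< j {x} {y} w x<y rest = record
    { ascentCount = suc k
    ; cofactor    = B₀ *ₚ Q
    ; lengths     = trans (cong length blocks-u) (trans (cong suc lengths)
        (trans (sym (ℕₚ.+-suc _ k)) (cong (ℕ._+ suc k)
          (sym (trans runs-u (trans (length-factors-yes _≤?_ w (ℕₚ.<⇒≤ x<y)) runs-tail))))))
    ; E-blocks    = begin
        E (blockComposition u)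
          ≈⟨ P.trans E-u (P.*-congʳ {t ^ₚ k *ₚ Q} B≋t*B₀) ⟩
        t *ₚ B₀ *ₚ (t ^ₚ k *ₚ Q)
          ≈⟨ PS.solve 4 (λ t b u q → let open PS in t :* b :* (u :* q) := t :* u :* (b :* q)) P.refl
               t B₀ (t ^ₚ k) Q ⟩
        t ^ₚ suc k *ₚ (B₀ *ₚ Q) ∎
    ; H-word      = t*-cancelˡ (begin
        t *ₚ H u
          ≈⟨ t*H-u 1# (λ p q → transK (g-ascent x<y p q) (symK (*-identityˡ _))) ⟩
        (t +ₚ 1ₚ) *ₚ (B *ₚ ((t +ₚ 1ₚ) ^ₚ k *ₚ Q))
          ≈⟨ P.*-congˡ {t +ₚ 1ₚ} (P.*-congʳ {(t +ₚ 1ₚ) ^ₚ k *ₚ Q} B≋t*B₀) ⟩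
        (t +ₚ 1ₚ) *ₚ (t *ₚ B₀ *ₚ ((t +ₚ 1ₚ) ^ₚ k *ₚ Q))
          ≈⟨ PS.solve 5 (λ z t b u q → let open PS in z :* (t :* b :* (u :* q)) := t :* (z :* u :* (b :* q)))
               P.refl (t +ₚ 1ₚ) t B₀ ((t +ₚ 1ₚ) ^ₚ k) Q ⟩
        t *ₚ ((t +ₚ 1ₚ) ^ₚ suc k *ₚ (B₀ *ₚ Q)) ∎)
    }
    where
    open Boundary j w (ℕₚ.<⇒≢ x<y) rest
    B₀ = ∑ₚ (splits (replicate j x)) (λ (u , v) → h (x ∷ u) • H v)
    B≋t*B₀ : B ≋ t *ₚ B₀
    B≋t*B₀ = H-∷ x (replicate j x)

  -- The new block adds to s and to r. With ε = 0 the junction factor is t itself and cancels at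
  -- once, so `B` enters the cofactor whole.
  factorization-> : ∀ j {x y} w → y < x → Factorization (y ∷ w) → Factorization (x ∷ replicate j x ++ y ∷ w)
  factorization-> j {x} {y} w y<x rest = record
    { ascentCount = k
    ; cofactor    = B *ₚ Q
    ; lengths     = trans (cong length blocks-u) (trans (cong suc lengths) (cong (ℕ._+ k)
        (sym (trans runs-u (trans (cong length (factors-no _≤?_ w (ℕₚ.<⇒≱ y<x))) (cong suc runs-tail))))))
    ; E-blocks    = P.trans E-u (exchange B (t ^ₚ k) Q)
    ; H-word      = t*-cancelˡ (begin
        t *ₚ H u
          ≈⟨ t*H-u 0# (λ p q → transK (g-descent y<x p q) (symK (zeroˡ _))) ⟩
        (t +ₚ const 0#) *ₚ (B *ₚ ((t +ₚ 1ₚ) ^ₚ k *ₚ Q))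
          ≈⟨ P.*-cong (P.trans (P.+-congˡ {t} const-0) (P.+-identityʳ t)) (exchange B ((t +ₚ 1ₚ) ^ₚ k) Q) ⟩
        t *ₚ ((t +ₚ 1ₚ) ^ₚ k *ₚ (B *ₚ Q)) ∎)
    }
    where
    open Boundary j w (ℕₚ.<⇒≢ y<x ∘ sym) rest
    exchange : ∀ p q r → p *ₚ (q *ₚ r) ≋ q *ₚ (p *ₚ r)
    exchange = PS.solve 3 (λ p q r → let open PS in p :* (q :* r) := q :* (p :* r)) P.refl
    const-0 : const 0# ≋ []
    const-0 = mk≋ λ { zero → reflK ; (suc n) → reflK }

  factorization-block : ∀ j x → Factorization (replicate (suc j) x)
  factorization-block j x = record
    { ascentCount = 0
    ; cofactor    = H (replicate (suc j) x)
    ; lengths     = trans (cong length one-block) (cong (ℕ._+ 0) (sym one-run))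
    ; E-blocks    = P.trans (P.reflexive (cong E one-block)) (P.trans
        (P.*-identityʳ (1/ suc j ! • (t *ₚ eulerian (suc j))))
        (P.trans (H-replicate j x) (P.sym (P.*-identityˡ (H (replicate (suc j) x))))))
    ; H-word      = P.sym (P.*-identityˡ (H (replicate (suc j) x)))
    }
    where
    one-block : blockComposition (replicate (suc j) x) ≡ [ suc j ]
    one-block = trans (cong (map length) (factors-≟-replicate j x)) (cong [_] (length-replicate (suc j)))
    one-run : length (runComposition (replicate (suc j) x)) ≡ 1
    one-run = trans (length-map length (factors _≤?_ (replicate (suc j) x)))
      (trans (cong (length ∘ factors _≤?_) (sym (++-identityʳ (replicate (suc j) x))))
             (length-factors-replicate _≤?_ ℕₚ.≤-refl j x []))

  -- `j` accumulates the current block, which makes the recursion structural in `w`; the block is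
  -- closed when a different letter follows.
  factorization : ∀ j x w → Factorization (x ∷ replicate j x ++ w)
  factorization j x []      = subst Factorization (sym (++-identityʳ (replicate (suc j) x))) (factorization-block j x)
  factorization j x (y ∷ w) with ℕₚ.<-cmp x y
  ... | tri< x<y _ _  = factorization-< j w x<y (factorization 0 y w)
  ... | tri> _ _ y<x  = factorization-> j w y<x (factorization 0 y w)
  ... | tri≈ _ refl _ = subst Factorization (cong (x ∷_) (replicate-++-∷ j x w)) (factorization (suc j) x w)

theorem9p1 : ∀ {a ℓ} (K : Field a ℓ) (char0 : CharacteristicZero K) →
    let open Over K char0 in
    (c : Word → K[t]) → IsExpansion c →
    (u : Word) → Packed u → u ≢ [] →
    let I = runComposition u
        J = blockComposition u
        r = length I
        s = length J
    in c u ≈ₚ ℱ (s ∸ r) (E J)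
theorem9p1 K char0 c c-exp []      pu u≢[] = ⊥-elim (u≢[] refl)
theorem9p1 K char0 c c-exp (x ∷ w) pu _    = λ n →
  transK (expansion-unique c c-exp u pu n) (coeffs (P.trans (g^ᵗ≋ℱH u) (begin
    ℱ 0 (H u)                                    ≈⟨ ℱ-cong 0 H-word ⟩
    ℱ 0 ((t +ₚ 1ₚ) ^ₚ ascentCount *ₚ cofactor)   ≈⟨ ℱ-t^ ascentCount cofactor ⟨
    ℱ ascentCount (t ^ₚ ascentCount *ₚ cofactor) ≈⟨ ℱ-cong ascentCount E-blocks ⟨
    ℱ ascentCount (E (blockComposition u))       ≡⟨ cong (λ p → ℱ p (E (blockComposition u))) s∸r≡a ⟨
    ℱ (s ∸ r) (E (blockComposition u))           ∎)) n)
  where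
  open Field K using (transK)
  open Over K char0
  open Polynomials K char0
  open BinomialBasis K char0
  open Junctions K char0
  open Blocks K char0
  open SetoidReasoning P.setoid
  u : Word
  u = x ∷ w
  r = length (runComposition u)
  s = length (blockComposition u)
  open Factorization (factorization 0 x w)
  s∸r≡a : s ∸ r ≡ ascentCount
  s∸r≡a = trans (cong (_∸ r) lengths) (ℕₚ.m+n∸m≡n r ascentCount)
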